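{- For $n\ge 8$ we have $m_3(n,2)=\lfloor n/2\rfloor$, and the unique $n$-vertex triangle-free graph with $\lfloor n/2\rfloor$ maximal independent sets of size $2$ is a comatching of order $n$. Moreover, as $n\to\infty$, $m_3(n,3)=\Theta(n)$ and $m_3(n,4)=\Theta(n^2)$.
   Context: A maximal independent set (MIS) is an independent set maximal with respect to inclusion. $m_3(n,k)$ denotes the maximum number of MIS's of size $k$ in a triangle-free graph on $n$ vertices. A comatching of order $n$ is the complete bipartite graph $K_{\lfloor n/2\rfloor,\lceil n/2\rceil}$ with a matching of size $\lfloor n/2\rfloor$ removed. -}

module Defs where

open import Data.Nat using (ℕ; zero; suc; _+_; _≡ᵇ_)
open import Data.Nat.DivMod using (_/_)
open import Data.Bool using (Bool; true; false; _∧_; _∨_; not; if_then_else_)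
open import Data.Fin using (Fin; toℕ)
open import Data.Fin.Subset using (Subset; ∣_∣)
open import Data.Fin.Permutation using (Permutation′; _⟨$⟩ʳ_)
open import Data.Vec using (Vec; []; _∷_; lookup)
open import Data.List using (List; []; _∷_; map; _++_; allFin)
open import Data.Bool.ListAction using (all)
open import Data.Product using (Σ; _×_; ∃)
open import Data.Empty using (⊥)
open import Relation.Binary.PropositionalEquality using (_≡_)
open import Relation.Nullary.Decidable using (⌊_⌋)
open import Data.Nat.Properties using (_≟_)

Adj : ℕ → Set
Adj n = Fin n → Fin n → Bool

IsGraph : ∀ {n} → Adj n → Set
IsGraph {n} A = (∀ (i j : Fin n) → A i j ≡ A j i) × (∀ (i : Fin n) → A i i ≡ false)

TriangleFree : ∀ {n} → Adj n → Set
TriangleFree {n} A = ∀ (i j k : Fin n) → A i j ≡ true → A j k ≡ true → A k i ≡ true → ⊥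

allSubsets : (n : ℕ) → List (Subset n)
allSubsets zero = [] ∷ []
allSubsets (suc n) = map (true ∷_) (allSubsets n) ++ map (false ∷_) (allSubsets n)

independent : ∀ {n} → Adj n → Subset n → Bool
independent {n} A S =
  all (λ i → all (λ j → not (lookup S i ∧ lookup S j ∧ A i j)) (allFin n)) (allFin n)

_⊆ᵇ_ : ∀ {n} → Subset n → Subset n → Bool
_⊆ᵇ_ {n} S T = all (λ i → not (lookup S i) ∨ lookup T i) (allFin n)

isMIS : ∀ {n} → Adj n → Subset n → Bool
isMIS {n} A S =
  independent A S ∧ all (λ T → not ((S ⊆ᵇ T) ∧ independent A T) ∨ (T ⊆ᵇ S)) (allSubsets n)

countᵇ : ∀ {a} {X : Set a} → (X → Bool) → List X → ℕ
countᵇ p [] = 0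
countᵇ p (x ∷ xs) = (if p x then 1 else 0) + countᵇ p xs

numMIS : ∀ {n} → Adj n → ℕ → ℕ
numMIS {n} A k = countᵇ (λ S → isMIS A S ∧ (∣ S ∣ ≡ᵇ k)) (allSubsets n)

IsM3 : ℕ → ℕ → ℕ → Set
IsM3 n k m =
  (∀ (A : Adj n) → IsGraph A → TriangleFree A → Data.Nat._≤_ (numMIS A k) m)
  × (Σ (Adj n) λ A → IsGraph A × TriangleFree A × numMIS A k ≡ m)

-- Comatching of order n: parts {0,…,⌊n/2⌋-1} and {⌊n/2⌋,…,n-1} (sizes ⌊n/2⌋, ⌈n/2⌉);
-- i and j adjacent iff in different parts and not matched, where vertex i < ⌊n/2⌋ is
-- matched with i + ⌊n/2⌋ (a matching of size ⌊n/2⌋).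
inA : ∀ {n} → Fin n → Bool
inA {n} i = ⌊ Data.Nat._<?_ (toℕ i) (n / 2) ⌋

comatching : (n : ℕ) → Adj n
comatching n i j =
  (inA i ∧ not (inA j) ∧ not ⌊ toℕ i + n / 2 ≟ toℕ j ⌋)
  ∨ (inA j ∧ not (inA i) ∧ not ⌊ toℕ j + n / 2 ≟ toℕ i ⌋)

Isomorphic : ∀ {n} → Adj n → Adj n → Set
Isomorphic {n} A B = Σ (Permutation′ n) λ π → ∀ (i j : Fin n) → A i j ≡ B (π ⟨$⟩ʳ i) (π ⟨$⟩ʳ j)

{-# OPTIONS --safe #-}
-- For pairs: the partners of a vertex u in maximal independent pairs are pairwise adjacent, so there
-- are at most two of them, and if there are two then almost all vertices are adjacent to u, which
-- leaves at most three pairs in the graph. Otherwise the pairs form a matching and number at most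
-- n / 2. If n / 2 ≥ 4 is attained, every vertex is adjacent to exactly one end of each pair avoiding
-- it, so one pair {a, b} splits the vertices into the independent sets {a} ∪ N(b) and {b} ∪ N(a),
-- between which only partners are non-adjacent.
--
-- For triples: as above, two vertices lie in at most two common triples. If each of x, y, z lay in
-- more than eight triples, one could choose triples {x, y₁, z₁}, {y, z₂, x₂}, {z, x₃, y₃} in general
-- position, and domination would force the triangle z₁ y₃ x₂. So every triple has an element
-- in at most eight triples, which gives at most 8n of them. The same argument among the sets containing a
-- fixed vertex gives at most 8n² quadruples. An isolated vertex plus a comatching, and two disjoint
-- comatchings, attain the orders n and n².
module Submission where

open import Defs
open import Data.Nat using (ℕ; zero; suc; _≤_; _≥_; _*_; _^_; _+_; _<_; z≤n; s≤s; _≡ᵇ_)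
open import Data.Nat.DivMod using (_/_; _%_)
import Data.Nat.DivMod as DivMod
import Data.Nat.Properties as ℕ
open import Data.Nat.Solver using (module +-*-Solver)
open import Data.Bool using (Bool; true; false; _∧_; _∨_; not; if_then_else_)
import Data.Bool.Properties as 𝔹
open import Data.Bool.ListAction using (all)
open import Data.Empty using (⊥; ⊥-elim)
open import Data.Fin using (Fin; zero; suc; toℕ; fromℕ<; combine; remQuot)
import Data.Fin.Properties as Fin
open import Data.Fin.Permutation using (permutation)
open import Data.Fin.Subset using (Subset; ∣_∣)
open import Data.Product using (Σ; ∃; _×_; _,_; proj₁; proj₂)
open import Data.Sum using (_⊎_; inj₁; inj₂)
open import Data.Vec as Vec using (lookup; []; _∷_)
import Data.Vec.Properties as Vec
open import Data.List using (List; []; _∷_; _++_; map; length; filter; allFin; tabulate) renaming (lookup to nth)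
import Data.List.Properties as List
open import Data.List.Membership.Propositional using (_∈_; _∉_)
open import Data.List.Membership.Propositional.Properties
open import Data.List.Relation.Unary.Any using (here; there)
open import Data.List.Relation.Unary.All as All using (All; []; _∷_)
open import Data.List.Relation.Unary.AllPairs as AllPairs using (AllPairs; []; _∷_)
open import Data.List.Relation.Unary.Unique.Propositional using (Unique)
import Data.List.Relation.Unary.Unique.Propositional.Properties as Unique
open import Function using (_∘_; case_of_)
open import Relation.Binary.PropositionalEquality
open import Relation.Nullary using (¬_; Dec; yes; no)
open import Relation.Nullary.Decidable using (⌊_⌋; ¬?; _×-dec_; _→-dec_)
open import Relation.Unary using (Decidable)

-- Pigeonhole arguments on lists without repetition

unique-⊆-length : ∀ {X : Set} {xs ys : List X} → Unique xs → (∀ {x} → x ∈ xs → x ∈ ys) →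
                  length xs ≤ length ys
unique-⊆-length {xs = []} _ _ = z≤n
unique-⊆-length {xs = x ∷ xs} (x∉ ∷ u) sub with ∈-∃++ (sub (here refl))
... | as , bs , refl =
  ℕ.≤-trans (s≤s (unique-⊆-length u sub′))
    (ℕ.≤-reflexive (sym (trans (List.length-++ as)
      (trans (ℕ.+-suc (length as) (length bs)) (cong suc (sym (List.length-++ as)))))))
  where
  sub′ : ∀ {y} → y ∈ xs → y ∈ as ++ bs
  sub′ y∈ with ∈-++⁻ as (sub (there y∈))
  ... | inj₁ y∈as = ∈-++⁺ˡ y∈as
  ... | inj₂ (here refl) = ⊥-elim (All.lookup x∉ y∈ refl)
  ... | inj₂ (there y∈bs) = ∈-++⁺ʳ as y∈bs

module _ {n : ℕ} where
  open import Data.List.Membership.DecPropositional (Fin._≟_ {n}) public using (_∈?_)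

fresh : ∀ {n} (xs : List (Fin n)) → length xs < n → ∃ λ v → v ∉ xs
fresh {n} xs short with Fin.any? (λ v → ¬? (v ∈? xs))
... | yes w = w
... | no none = ⊥-elim (ℕ.<⇒≱ short (ℕ.≤-trans (ℕ.≤-reflexive (sym (List.length-tabulate (λ i → i))))
                  (unique-⊆-length (Unique.allFin⁺ n) λ {v} _ → covered v)))
  where
  covered : ∀ v → v ∈ xs
  covered v with v ∈? xs
  ... | yes v∈ = v∈
  ... | no v∉ = ⊥-elim (none (v , v∉))

module _ {X : Set} where

  Unique-three : ∀ {xs : List X} → Unique xs → 3 ≤ length xs →
                 ∃ λ a → ∃ λ b → ∃ λ c → (a ∈ xs × b ∈ xs × c ∈ xs) × (a ≢ b × b ≢ c × a ≢ c)
  Unique-three {a ∷ b ∷ c ∷ _} ((a≢b ∷ a≢c ∷ _) ∷ (b≢c ∷ _) ∷ _) _ =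
    a , b , c , (here refl , there (here refl) , there (there (here refl))) , (a≢b , b≢c , a≢c)
  Unique-three {_ ∷ []} _ (s≤s ())
  Unique-three {_ ∷ _ ∷ []} _ (s≤s (s≤s ()))

  Unique-two : ∀ {xs : List X} → Unique xs → 2 ≤ length xs →
               ∃ λ a → ∃ λ b → (a ∈ xs × b ∈ xs) × a ≢ b
  Unique-two {a ∷ b ∷ _} ((a≢b ∷ _) ∷ _) _ = a , b , (here refl , there (here refl)) , a≢b
  Unique-two {_ ∷ []} _ (s≤s ())

  length≤1⇒≡ : ∀ {xs : List X} {a b} → Unique xs → length xs ≤ 1 → a ∈ xs → b ∈ xs → a ≡ b
  length≤1⇒≡ {_ ∷ []} _ _ (here refl) (here refl) = refl
  length≤1⇒≡ {_ ∷ _ ∷ _} _ (s≤s ())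

  length-filter-split : ∀ {P : X → Set} (P? : Decidable P) xs →
    length xs ≡ length (filter P? xs) + length (filter (¬? ∘ P?) xs)
  length-filter-split P? [] = refl
  length-filter-split P? (x ∷ xs) with P? x
  ... | yes _ = cong suc (length-filter-split P? xs)
  ... | no _ = trans (cong suc (length-filter-split P? xs)) (sym (ℕ.+-suc _ _))

  countᵇ≡length : (p : X → Bool) (xs : List X) → countᵇ p xs ≡ length (filter (λ x → p x 𝔹.≟ true) xs)
  countᵇ≡length p [] = refl
  countᵇ≡length p (x ∷ xs) with p x
  ... | true = cong suc (countᵇ≡length p xs)
  ... | false = countᵇ≡length p xs

all⇒ : ∀ {X : Set} {p : X → Bool} {xs x} → all p xs ≡ true → x ∈ xs → p x ≡ true
all⇒ {p = p} {y ∷ xs} h x∈ with p y in eq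
all⇒ h (here refl) | true = eq
all⇒ h (there x∈) | true = all⇒ h x∈

⇒all : ∀ {X : Set} {p : X → Bool} xs → (∀ x → p x ≡ true) → all p xs ≡ true
⇒all [] h = refl
⇒all {p = p} (x ∷ xs) h rewrite h x = ⇒all xs h

∧-true : ∀ {a b} → a ∧ b ≡ true → a ≡ true × b ≡ true
∧-true {true} {true} _ = refl , refl

¬true⇒false : ∀ {b} → ¬ b ≡ true → b ≡ false
¬true⇒false {true} h = ⊥-elim (h refl)
¬true⇒false {false} _ = refl

Bool-ext : ∀ {a b} → (a ≡ true → b ≡ true) → (b ≡ true → a ≡ true) → a ≡ b
Bool-ext {true} f _ = sym (f refl)
Bool-ext {false} {true} _ g = g refl
Bool-ext {false} {false} _ _ = refl

-- Vertex sets

_∈ˢ_ : ∀ {n} → Fin n → Subset n → Set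
v ∈ˢ S = lookup S v ≡ true

_∈ˢ?_ : ∀ {n} (v : Fin n) (S : Subset n) → Dec (v ∈ˢ S)
v ∈ˢ? S = lookup S v 𝔹.≟ true

∈ˢ-ext : ∀ {n} {S T : Subset n} → (∀ v → v ∈ˢ S → v ∈ˢ T) → (∀ v → v ∈ˢ T → v ∈ˢ S) → S ≡ T
∈ˢ-ext {S = []} {[]} _ _ = refl
∈ˢ-ext {S = a ∷ S} {b ∷ T} f g = cong₂ _∷_ (Bool-ext (f zero) (g zero)) (∈ˢ-ext (f ∘ suc) (g ∘ suc))

allSubsets-complete : ∀ {n} (S : Subset n) → S ∈ allSubsets n
allSubsets-complete [] = here refl
allSubsets-complete (true ∷ S) = ∈-++⁺ˡ (∈-map⁺ (true ∷_) (allSubsets-complete S))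
allSubsets-complete {suc n} (false ∷ S) =
  ∈-++⁺ʳ (map (true ∷_) (allSubsets n)) (∈-map⁺ (false ∷_) (allSubsets-complete S))

allSubsets-unique : ∀ n → Unique (allSubsets n)
allSubsets-unique zero = [] ∷ []
allSubsets-unique (suc n) = Unique.++⁺ (Unique.map⁺ Vec.∷-injectiveʳ (allSubsets-unique n))
  (Unique.map⁺ Vec.∷-injectiveʳ (allSubsets-unique n)) disjoint
  where
  disjoint : ∀ {S} → S ∈ map (true ∷_) (allSubsets n) × S ∈ map (false ∷_) (allSubsets n) → ⊥
  disjoint (p , q) with ∈-map⁻ (true ∷_) p | ∈-map⁻ (false ∷_) q
  ... | _ , _ , refl | _ , _ , ()

-- An enumeration without repetition, so that the size of a set becomes the length of a list and
-- matching on that list names its elements.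
record Lists {n} (S : Subset n) (xs : List (Fin n)) : Set where
  constructor lists
  field
    unique : Unique xs
    to     : ∀ {v} → v ∈ˢ S → v ∈ xs
    from   : ∀ {v} → v ∈ xs → v ∈ˢ S

open Lists

elements : ∀ {n} → Subset n → List (Fin n)
elements [] = []
elements (true ∷ S) = zero ∷ map suc (elements S)
elements (false ∷ S) = map suc (elements S)

length-elements : ∀ {n} (S : Subset n) → length (elements S) ≡ ∣ S ∣
length-elements [] = refl
length-elements (true ∷ S) = cong suc (trans (List.length-map suc (elements S)) (length-elements S))
length-elements (false ∷ S) = trans (List.length-map suc (elements S)) (length-elements S)

elements-lists : ∀ {n} (S : Subset n) → Lists S (elements S)
elements-lists [] = lists [] (λ { {()} }) λ ()
elements-lists (true ∷ S) with elements-lists S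
... | lists u t f = lists (All.tabulate zero-fresh ∷ Unique.map⁺ Fin.suc-injective u)
  (λ { {zero} _ → here refl ; {suc v} h → there (∈-map⁺ suc (t h)) })
  (λ { (here refl) → refl ; (there h) → case ∈-map⁻ suc h of λ { (_ , h′ , refl) → f h′ } })
  where
  zero-fresh : ∀ {v} → v ∈ map suc (elements S) → zero ≢ v
  zero-fresh h refl with ∈-map⁻ suc h
  ... | _ , _ , ()
elements-lists (false ∷ S) with elements-lists S
... | lists u t f = lists (Unique.map⁺ Fin.suc-injective u)
  (λ { {zero} () ; {suc v} h → ∈-map⁺ suc (t h) })
  (λ h → case ∈-map⁻ suc h of λ { (_ , h′ , refl) → f h′ })

lists-length : ∀ {n} {S : Subset n} {xs} → Lists S xs → length xs ≡ ∣ S ∣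
lists-length {S = S} {xs} (lists u t f) with elements-lists S
... | lists u′ t′ f′ = trans (ℕ.≤-antisym (unique-⊆-length u (t′ ∘ f)) (unique-⊆-length u′ (t ∘ f′)))
                             (length-elements S)

-- Puts the known elements `ys` at the end of an enumeration. The size of `S` then fixes the length
-- of `zs`, and with it the number of elements still to be named.
complete : ∀ {n} {S : Subset n} {ys} → Unique ys → (∀ {v} → v ∈ ys → v ∈ˢ S) →
           ∃ λ zs → Lists S (zs ++ ys)
complete {S = S} {ys} u sub = zs , lists (Unique.++⁺ (Unique.filter⁺ new? (unique L)) u disjoint) to′ from′
  where
  L = elements-lists S
  new? : ∀ v → Dec (¬ v ∈ ys)
  new? v = ¬? (v ∈? ys)
  zs = filter new? (elements S)
  disjoint : ∀ {v} → v ∈ zs × v ∈ ys → ⊥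
  disjoint (p , q) = proj₂ (∈-filter⁻ new? {xs = elements S} p) q
  to′ : ∀ {v} → v ∈ˢ S → v ∈ zs ++ ys
  to′ {v} v∈S with v ∈? ys
  ... | yes v∈ys = ∈-++⁺ʳ zs v∈ys
  ... | no v∉ys = ∈-++⁺ˡ (∈-filter⁺ new? (to L v∈S) v∉ys)
  from′ : ∀ {v} → v ∈ zs ++ ys → v ∈ˢ S
  from′ h with ∈-++⁻ zs h
  ... | inj₁ p = from L (proj₁ (∈-filter⁻ new? {xs = elements S} p))
  ... | inj₂ q = sub q

fromList : ∀ {n} → List (Fin n) → Subset n
fromList xs = Vec.tabulate (λ v → ⌊ v ∈? xs ⌋)

fromList-lists : ∀ {n} {xs : List (Fin n)} → Unique xs → Lists (fromList xs) xs
fromList-lists {xs = xs} u = lists u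
  (λ {v} h → to′ v (trans (sym (Vec.lookup∘tabulate (λ v → ⌊ v ∈? xs ⌋) v)) h))
  (λ {v} h → trans (Vec.lookup∘tabulate (λ v → ⌊ v ∈? xs ⌋) v) (from′ v h))
  where
  to′ : ∀ v → ⌊ v ∈? xs ⌋ ≡ true → v ∈ xs
  to′ v h with yes p ← v ∈? xs = p
  from′ : ∀ v → v ∈ xs → ⌊ v ∈? xs ⌋ ≡ true
  from′ v h with v ∈? xs
  ... | yes _ = refl
  ... | no v∉ = ⊥-elim (v∉ h)

-- Maximal independent sets

-- Maximality in the local form used throughout: in place of a quantifier over larger sets, every
-- outside vertex has a neighbour inside.
record IsMIS {n} (A : Adj n) (S : Subset n) : Set where
  constructor mis
  field
    nonadjacent : ∀ {u v} → u ∈ˢ S → v ∈ˢ S → A u v ≡ true → ⊥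
    dominating  : ∀ {v} → ¬ v ∈ˢ S → ∃ λ u → u ∈ˢ S × A u v ≡ true

open IsMIS

independent⇒ : ∀ {n} (A : Adj n) S → independent A S ≡ true →
               ∀ {u v} → u ∈ˢ S → v ∈ˢ S → A u v ≡ true → ⊥
independent⇒ A S h {u} {v} u∈ v∈ uv
  with e ← all⇒ (all⇒ h (∈-allFin u)) (∈-allFin v)
  rewrite u∈ | v∈ | uv = case e of λ ()

⇒independent : ∀ {n} (A : Adj n) S → (∀ {u v} → u ∈ˢ S → v ∈ˢ S → A u v ≡ true → ⊥) →
               independent A S ≡ true
⇒independent {n} A S h = ⇒all (allFin n) λ u → ⇒all (allFin n) (entry u)
  where
  entry : ∀ u v → not (lookup S u ∧ lookup S v ∧ A u v) ≡ true
  entry u v with lookup S u in eu | lookup S v in ev | A u v in e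
  ... | false | _ | _ = refl
  ... | true | false | _ = refl
  ... | true | true | false = refl
  ... | true | true | true = ⊥-elim (h eu ev e)

⊆ᵇ⇒ : ∀ {n} (S T : Subset n) → S ⊆ᵇ T ≡ true → ∀ {v} → v ∈ˢ S → v ∈ˢ T
⊆ᵇ⇒ S T h {v} v∈ with e ← all⇒ h (∈-allFin v) rewrite v∈ = e

⇒⊆ᵇ : ∀ {n} (S T : Subset n) → (∀ {v} → v ∈ˢ S → v ∈ˢ T) → S ⊆ᵇ T ≡ true
⇒⊆ᵇ {n} S T h = ⇒all (allFin n) entry
  where
  entry : ∀ v → not (lookup S v) ∨ lookup T v ≡ true
  entry v with lookup S v in e
  ... | true = h e
  ... | false = refl

-- A vertex `v` outside `S` without a neighbour in `S` could be added to `S`, giving a larger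
-- independent set `T`.
isMIS⇒IsMIS : ∀ {n} {A : Adj n} → IsGraph A → ∀ S → isMIS A S ≡ true → IsMIS A S
isMIS⇒IsMIS {A = A} (Asym , irr) S h = mis ind (λ {v} → dominated v)
  where
  ind : ∀ {u v} → u ∈ˢ S → v ∈ˢ S → A u v ≡ true → ⊥
  ind = independent⇒ A S (proj₁ (∧-true {independent A S} h))
  maximal : ∀ T → S ⊆ᵇ T ≡ true → independent A T ≡ true → T ⊆ᵇ S ≡ true
  maximal T p q = implied p q (all⇒ {p = λ T → not ((S ⊆ᵇ T) ∧ independent A T) ∨ (T ⊆ᵇ S)}
    (proj₂ (∧-true {independent A S} h)) (allSubsets-complete T))
    where
    implied : ∀ {a b c} → a ≡ true → b ≡ true → not (a ∧ b) ∨ c ≡ true → c ≡ true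
    implied refl refl e = e
  dominated : ∀ v → ¬ v ∈ˢ S → ∃ λ u → u ∈ˢ S × A u v ≡ true
  dominated v v∉ with Fin.any? (λ u → (u ∈ˢ? S) ×-dec (A u v 𝔹.≟ true))
  ... | yes w = w
  ... | no none = ⊥-elim (v∉ (⊆ᵇ⇒ T S (maximal T (⇒⊆ᵇ S T S⊆T) (⇒independent A T indT))
                          (Vec.lookup∘update v S true)))
    where
    T = S Vec.[ v ]≔ true
    S⊆T : ∀ {u} → u ∈ˢ S → u ∈ˢ T
    S⊆T {u} u∈ with u Fin.≟ v
    ... | yes refl = Vec.lookup∘update v S true
    ... | no u≢v = trans (Vec.lookup∘update′ u≢v S true) u∈
    T⊆ : ∀ {u} → u ∈ˢ T → u ≡ v ⊎ u ∈ˢ S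
    T⊆ {u} u∈ with u Fin.≟ v
    ... | yes e = inj₁ e
    ... | no u≢v = inj₂ (trans (sym (Vec.lookup∘update′ u≢v S true)) u∈)
    indT : ∀ {u w} → u ∈ˢ T → w ∈ˢ T → A u w ≡ true → ⊥
    indT {u} {w} u∈ w∈ uw with T⊆ u∈ | T⊆ w∈
    ... | inj₁ refl | inj₁ refl = case trans (sym uw) (irr v) of λ ()
    ... | inj₁ refl | inj₂ p = none (w , p , trans (Asym w u) uw)
    ... | inj₂ p | inj₁ refl = none (u , p , uw)
    ... | inj₂ p | inj₂ q = ind p q uw

IsMIS⇒isMIS : ∀ {n} {A : Adj n} {S} → IsMIS A S → isMIS A S ≡ true
IsMIS⇒isMIS {n} {A} {S} (mis ind dom) =
  cong₂ _∧_ (⇒independent A S ind) (⇒all (allSubsets n) entry)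
  where
  entry : ∀ T → not ((S ⊆ᵇ T) ∧ independent A T) ∨ (T ⊆ᵇ S) ≡ true
  entry T with S ⊆ᵇ T in p | independent A T in q
  ... | false | _ = refl
  ... | true | false = refl
  ... | true | true = ⇒⊆ᵇ T S T⊆S
    where
    T⊆S : ∀ {v} → v ∈ˢ T → v ∈ˢ S
    T⊆S {v} v∈T with v ∈ˢ? S
    ... | yes v∈S = v∈S
    ... | no v∉S with u , u∈S , uv ← dom v∉S =
      ⊥-elim (independent⇒ A T q (⊆ᵇ⇒ S T p u∈S) v∈T uv)

misSets : ∀ {n} → Adj n → ℕ → List (Subset n)
misSets {n} A k = filter (λ S → (isMIS A S ∧ (∣ S ∣ ≡ᵇ k)) 𝔹.≟ true) (allSubsets n)

numMIS≡length : ∀ {n} (A : Adj n) k → numMIS A k ≡ length (misSets A k)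
numMIS≡length {n} A k = countᵇ≡length _ (allSubsets n)

misSets-unique : ∀ {n} (A : Adj n) k → Unique (misSets A k)
misSets-unique {n} A k = Unique.filter⁺ _ (allSubsets-unique n)

misSets⇒ : ∀ {n} {A : Adj n} {k S} → IsGraph A → S ∈ misSets A k → IsMIS A S × ∣ S ∣ ≡ k
misSets⇒ {n} {A} {k} {S} gr S∈
  with p , q ← ∧-true {isMIS A S} (proj₂ (∈-filter⁻ (λ S → (isMIS A S ∧ (∣ S ∣ ≡ᵇ k)) 𝔹.≟ true)
                                        {xs = allSubsets n} S∈)) =
  isMIS⇒IsMIS gr S p , ℕ.≡ᵇ⇒≡ _ _ (subst Data.Bool.T (sym q) _)

⇒misSets : ∀ {n} {A : Adj n} {S} → IsMIS A S → S ∈ misSets A ∣ S ∣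
⇒misSets {n} {A} {S} h = ∈-filter⁺ _ (allSubsets-complete S)
  (cong₂ _∧_ (IsMIS⇒isMIS h) (≡ᵇ-refl ∣ S ∣))
  where
  ≡ᵇ-refl : ∀ m → (m ≡ᵇ m) ≡ true
  ≡ᵇ-refl zero = refl
  ≡ᵇ-refl (suc m) = ≡ᵇ-refl m

-- Existence of the maximum

-- A type of functions on `Fin n` is finite only up to pointwise equality, so a maximum is claimed
-- for those `f` that respect `≈`.
HasMax : (X : Set) → (X → X → Set) → Set
HasMax X _≈_ = (f : X → ℕ) → (∀ {a b} → a ≈ b → f a ≡ f b) → ∃ λ a → ∀ b → f b ≤ f a

hasMax-Bool : HasMax Bool _≡_
hasMax-Bool f _ with ℕ.≤-total (f true) (f false)
... | inj₁ t≤f = false , λ { true → t≤f ; false → ℕ.≤-refl }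
... | inj₂ f≤t = true , λ { true → ℕ.≤-refl ; false → f≤t }

-- Maximise over the tail for each head, then over the head. For equivalent heads the chosen tails
-- may differ, but each of the two maxima bounds the other, so `F` respects `≈`.
hasMax-Π : ∀ {X : Set} {_≈_ : X → X → Set} → (∀ {x} → x ≈ x) → HasMax X _≈_ →
           ∀ n → HasMax (Fin n → X) (λ g h → ∀ i → g i ≈ h i)
hasMax-Π ≈-refl max zero f ext = (λ ()) , λ g → ℕ.≤-reflexive (ext λ ())
hasMax-Π {X} {_≈_} ≈-refl max (suc n) f ext = cons x̂ (best x̂) , bound
  where
  cons : X → (Fin n → X) → Fin (suc n) → X
  cons x g zero = x
  cons x g (suc i) = g i
  cons-ext : ∀ {x y g} → x ≈ y → ∀ i → cons x g i ≈ cons y g i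
  cons-ext x≈y zero = x≈y
  cons-ext x≈y (suc i) = ≈-refl
  tailMax : ∀ x → ∃ λ g → ∀ h → f (cons x h) ≤ f (cons x g)
  tailMax x = hasMax-Π ≈-refl max n (f ∘ cons x)
    λ e → ext λ { zero → ≈-refl ; (suc i) → e i }
  best : X → Fin n → X
  best x = proj₁ (tailMax x)
  F : X → ℕ
  F x = f (cons x (best x))
  F-ext : ∀ {x y} → x ≈ y → F x ≡ F y
  F-ext {x} {y} x≈y = ℕ.≤-antisym
    (ℕ.≤-trans (ℕ.≤-reflexive (ext (cons-ext x≈y))) (proj₂ (tailMax y) (best x)))
    (ℕ.≤-trans (proj₂ (tailMax y) (best y)) (ℕ.≤-trans (ℕ.≤-reflexive (sym (ext (cons-ext x≈y))))
      (proj₂ (tailMax x) (best y))))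
  x̂ : X
  x̂ = proj₁ (max F F-ext)
  bound : ∀ g → f g ≤ F x̂
  bound g = ℕ.≤-trans (ℕ.≤-reflexive (ext λ { zero → ≈-refl ; (suc i) → ≈-refl }))
    (ℕ.≤-trans (proj₂ (tailMax (g zero)) (g ∘ suc)) (proj₂ (max F F-ext) (g zero)))

_≗₂_ : ∀ {n} → Adj n → Adj n → Set
A ≗₂ B = ∀ i j → A i j ≡ B i j

all-cong : ∀ {X : Set} {p q : X → Bool} → (∀ x → p x ≡ q x) → ∀ xs → all p xs ≡ all q xs
all-cong h [] = refl
all-cong h (x ∷ xs) = cong₂ _∧_ (h x) (all-cong h xs)

countᵇ-cong : ∀ {X : Set} {p q : X → Bool} → (∀ x → p x ≡ q x) → ∀ xs → countᵇ p xs ≡ countᵇ q xs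
countᵇ-cong h [] = refl
countᵇ-cong h (x ∷ xs) = cong₂ (λ b m → (if b then 1 else 0) + m) (h x) (countᵇ-cong h xs)

numMIS-cong : ∀ {n} {A B : Adj n} → A ≗₂ B → ∀ k → numMIS A k ≡ numMIS B k
numMIS-cong {n} {A} {B} e k = countᵇ-cong (λ S → cong (_∧ (∣ S ∣ ≡ᵇ k)) (isMIS-cong S)) (allSubsets n)
  where
  independent-cong : ∀ S → independent A S ≡ independent B S
  independent-cong S = all-cong (λ i → all-cong
    (λ j → cong (λ b → not (lookup S i ∧ lookup S j ∧ b)) (e i j)) (allFin n)) (allFin n)
  isMIS-cong : ∀ S → isMIS A S ≡ isMIS B S
  isMIS-cong S = cong₂ _∧_ (independent-cong S) (all-cong
    (λ T → cong (λ b → not ((S ⊆ᵇ T) ∧ b) ∨ (T ⊆ᵇ S)) (independent-cong T)) (allSubsets n))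

emptyGraph : ∀ n → Adj n
emptyGraph n _ _ = false

emptyGraph-valid : ∀ n → IsGraph (emptyGraph n) × TriangleFree (emptyGraph n)
emptyGraph-valid n = ((λ _ _ → refl) , λ _ → refl) , λ _ _ _ ()

Valid : ∀ {n} → Adj n → Set
Valid A = IsGraph A × TriangleFree A

valid? : ∀ {n} (A : Adj n) → Dec (Valid A)
valid? A = (Fin.all? (λ i → Fin.all? λ j → A i j 𝔹.≟ A j i) ×-dec Fin.all? (λ i → A i i 𝔹.≟ false))
  ×-dec Fin.all? (λ i → Fin.all? λ j → Fin.all? λ k →
          (A i j 𝔹.≟ true) →-dec ((A j k 𝔹.≟ true) →-dec ((A k i 𝔹.≟ true) →-dec no λ ())))

valid-cong : ∀ {n} {A B : Adj n} → A ≗₂ B → Valid A → Valid B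
valid-cong e ((sy , irr) , tf) =
  ((λ i j → trans (sym (e i j)) (trans (sy i j) (e j i))) , λ i → trans (sym (e i i)) (irr i)) ,
  λ i j k p q r → tf i j k (trans (e i j) p) (trans (e j k) q) (trans (e k i) r)

-- Invalid adjacency functions are replaced by the empty graph, which leaves the maximum unchanged.
normalise : ∀ {n} (A : Adj n) → Dec (Valid A) → Adj n
normalise A (yes _) = A
normalise {n} A (no _) = emptyGraph n

normalise-valid : ∀ {n} (A : Adj n) d → Valid (normalise A d)
normalise-valid A (yes v) = v
normalise-valid {n} A (no _) = emptyGraph-valid n

normalise-id : ∀ {n} (A : Adj n) → Valid A → ∀ d → normalise A d ≡ A
normalise-id A v (yes _) = refl
normalise-id A v (no ¬v) = ⊥-elim (¬v v)

normalise-cong : ∀ {n} {A B : Adj n} → A ≗₂ B → ∀ d d′ → normalise A d ≗₂ normalise B d′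
normalise-cong e (yes _) (yes _) = e
normalise-cong e (no _) (no _) = λ _ _ → refl
normalise-cong e (yes a) (no ¬b) = ⊥-elim (¬b (valid-cong e a))
normalise-cong e (no ¬a) (yes b) = ⊥-elim (¬a (valid-cong (λ i j → sym (e i j)) b))

abstract
  hasMax-Adj : ∀ n → HasMax (Adj n) _≗₂_
  hasMax-Adj n = hasMax-Π (λ _ → refl) (hasMax-Π refl hasMax-Bool n) n

-- The growth statements assert a value of the extremal function for every large `n`; it is found by
-- comparing the finitely many graphs on `n` vertices.
IsM3-maximum : ∀ n k → ∃ λ m → IsM3 n k m
IsM3-maximum n k = value Â , upper , nf Â , proj₁ (valid Â) , proj₂ (valid Â) , refl
  where
  nf : Adj n → Adj n
  nf A = normalise A (valid? A)
  valid : ∀ A → Valid (nf A)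
  valid A = normalise-valid A (valid? A)
  value : Adj n → ℕ
  value A = numMIS (nf A) k
  maximum : ∃ λ A → ∀ B → value B ≤ value A
  maximum = hasMax-Adj n value λ {A} {B} e → numMIS-cong (normalise-cong e (valid? A) (valid? B)) k
  Â : Adj n
  Â = proj₁ maximum
  upper : ∀ A → IsGraph A → TriangleFree A → numMIS A k ≤ value Â
  upper A g t = subst (λ B → numMIS B k ≤ value Â) (normalise-id A (g , t) (valid? A)) (proj₂ maximum A)

abstract
  IsM3-exists : ∀ n k → ∃ λ m → IsM3 n k m
  IsM3-exists = IsM3-maximum

-- Counting in families of vertex sets

module _ {n : ℕ} where

  star : List (Subset n) → Fin n → List (Subset n)
  star 𝓖 v = filter (v ∈ˢ?_) 𝓖

  deg : List (Subset n) → Fin n → ℕ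
  deg 𝓖 v = length (star 𝓖 v)

  without : List (Subset n) → Fin n → List (Subset n)
  without 𝓖 v = filter (λ S → ¬? (v ∈ˢ? S)) 𝓖

  star⁻ : ∀ 𝓖 v {S} → S ∈ star 𝓖 v → S ∈ 𝓖 × v ∈ˢ S
  star⁻ 𝓖 v = ∈-filter⁻ (v ∈ˢ?_) {xs = 𝓖}

  without⁻ : ∀ 𝓖 v {S} → S ∈ without 𝓖 v → S ∈ 𝓖 × ¬ v ∈ˢ S
  without⁻ 𝓖 v = ∈-filter⁻ (λ S → ¬? (v ∈ˢ? S)) {xs = 𝓖}

  star-unique : ∀ {𝓖} → Unique 𝓖 → ∀ v → Unique (star 𝓖 v)
  star-unique u v = Unique.filter⁺ (v ∈ˢ?_) u

  without-unique : ∀ {𝓖} → Unique 𝓖 → ∀ v → Unique (without 𝓖 v)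
  without-unique u v = Unique.filter⁺ (λ S → ¬? (v ∈ˢ? S)) u

  length-split : ∀ 𝓖 v → length 𝓖 ≡ deg 𝓖 v + length (without 𝓖 v)
  length-split 𝓖 v = length-filter-split (v ∈ˢ?_) 𝓖

  deg-mono : ∀ {𝓖 𝓗} → Unique 𝓖 → (∀ {S} → S ∈ 𝓖 → S ∈ 𝓗) → ∀ v → deg 𝓖 v ≤ deg 𝓗 v
  deg-mono {𝓖} u sub v = unique-⊆-length (star-unique u v)
    λ S∈ → let p , q = star⁻ 𝓖 v S∈ in ∈-filter⁺ (v ∈ˢ?_) (sub p) q

  -- Discard for each vertex of `F` the at most `C` sets through it; the strict inequality leaves at
  -- least one set.
  avoiding : ∀ {C} 𝓖 F → Unique 𝓖 → (∀ {f} → f ∈ F → deg 𝓖 f ≤ C) → length F * C < length 𝓖 →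
             ∃ λ S → S ∈ 𝓖 × (∀ {f} → f ∈ F → ¬ f ∈ˢ S)
  avoiding (S ∷ 𝓖) [] _ _ _ = S , here refl , λ ()
  avoiding {C} 𝓖 (f ∷ F) u small large
    with avoiding (without 𝓖 f) F (without-unique u f)
           (λ {g} g∈ → ℕ.≤-trans (deg-mono (without-unique u f) (proj₁ ∘ without⁻ 𝓖 f) g) (small (there g∈)))
           (ℕ.+-cancelˡ-< C _ _ (ℕ.<-≤-trans large
             (ℕ.≤-trans (ℕ.≤-reflexive (length-split 𝓖 f)) (ℕ.+-monoˡ-≤ _ (small (here refl))))))
  ... | S , S∈ , avoids with S∈𝓖 , f∉S ← without⁻ 𝓖 f S∈ =
    S , S∈𝓖 , λ { (here refl) → f∉S ; (there g∈) → avoids g∈ }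

  -- Process `V` in order. A vertex of degree at most `C` in the current family accounts for at most
  -- `C` sets, which are removed, and degrees in the rest can only drop. A vertex of larger degree
  -- is the witness of no set and is passed over.
  cover-bound : ∀ {C} 𝓖 V → Unique 𝓖 →
                (∀ {S} → S ∈ 𝓖 → ∃ λ v → v ∈ V × v ∈ˢ S × deg 𝓖 v ≤ C) →
                length 𝓖 ≤ length V * C
  cover-bound [] [] _ _ = z≤n
  cover-bound (S ∷ 𝓖) [] _ cov with () ← proj₁ (proj₂ (cov (here refl)))
  cover-bound {C} 𝓖 (v ∷ V) u cov with deg 𝓖 v ℕ.≤? C
  ... | yes light = ℕ.≤-trans (ℕ.≤-reflexive (length-split 𝓖 v)) (ℕ.+-mono-≤ light
    (cover-bound (without 𝓖 v) V (without-unique u v) cov′))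
    where
    cov′ : ∀ {S} → S ∈ without 𝓖 v → ∃ λ w → w ∈ V × w ∈ˢ S × deg (without 𝓖 v) w ≤ C
    cov′ {S} S∈ with S∈𝓖 , v∉S ← without⁻ 𝓖 v S∈ | cov (proj₁ (without⁻ 𝓖 v S∈))
    ... | w , here refl , w∈S , _ = ⊥-elim (v∉S w∈S)
    ... | w , there w∈V , w∈S , d = w , w∈V , w∈S ,
      ℕ.≤-trans (deg-mono (without-unique u v) (proj₁ ∘ without⁻ 𝓖 v) w) d
  ... | no heavy = ℕ.≤-trans (cover-bound 𝓖 V u cov′) (ℕ.m≤n+m _ C)
    where
    cov′ : ∀ {S} → S ∈ 𝓖 → ∃ λ w → w ∈ V × w ∈ˢ S × deg 𝓖 w ≤ C
    cov′ S∈ with cov S∈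
    ... | w , here refl , _ , d = ⊥-elim (heavy d)
    ... | w , there w∈V , rest = w , w∈V , rest

  cover-bound-all : ∀ {C} 𝓖 → Unique 𝓖 → (∀ {S} → S ∈ 𝓖 → ∃ λ v → v ∈ˢ S × deg 𝓖 v ≤ C) →
                    length 𝓖 ≤ n * C
  cover-bound-all {C} 𝓖 u cov = subst (λ m → length 𝓖 ≤ m * C) (List.length-tabulate (λ (i : Fin n) → i))
    (cover-bound 𝓖 (allFin n) u λ S∈ → let v , rest = cov S∈ in v , ∈-allFin v , rest)

-- Maximal independent sets sharing all but one element

module TriangleFreeGraph {n : ℕ} (A : Adj n) (graph : IsGraph A) (tri : TriangleFree A) where

  _~_ : Fin n → Fin n → Set
  u ~ v = A u v ≡ true

  ~-sym : ∀ {u v} → u ~ v → v ~ u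
  ~-sym {u} {v} uv = trans (proj₁ graph v u) uv

  ~-irrefl : ∀ {v} → ¬ v ~ v
  ~-irrefl {v} vv = case trans (sym vv) (proj₂ graph v) of λ ()

  no-triangle : ∀ {u v w} → u ~ v → v ~ w → ¬ u ~ w
  no-triangle uv vw uw = tri _ _ _ uv vw (~-sym uw)

  -- The missing vertices of two such sets are adjacent, since the rest of the set is common to both.
  one-element-extensions : ∀ {𝓖} R → Unique 𝓖 → Unique R →
    (∀ {S} → S ∈ 𝓖 → IsMIS A S × ∣ S ∣ ≡ suc (length R) × (∀ {v} → v ∈ R → v ∈ˢ S)) →
    length 𝓖 ≤ 2
  one-element-extensions {𝓖} R u uR fam = ℕ.≮⇒≥ λ large →
    let S₁ , S₂ , S₃ , (p₁ , p₂ , p₃) , (d₁₂ , d₂₃ , d₁₃) = Unique-three u large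
    in no-triangle (adjacent p₁ p₂ d₁₂) (adjacent p₂ p₃ d₂₃) (adjacent p₁ p₃ d₁₃)
    where
    extra : ∀ {S} → S ∈ 𝓖 → ∃ λ z → Lists S (z ∷ R)
    extra S∈ with _ , size , R⊆S ← fam S∈ | complete uR (proj₂ (proj₂ (fam S∈)))
    ... | zs , L with ℕ.+-cancelʳ-≡ (length R) (length zs) 1
                        (trans (sym (List.length-++ zs)) (trans (lists-length L) size))
    ... | one with z ∷ [] ← zs = z , L
    adjacent : ∀ {S T} (p : S ∈ 𝓖) (q : T ∈ 𝓖) → S ≢ T → proj₁ (extra p) ~ proj₁ (extra q)
    adjacent {S} {T} p q S≢T with extra p | extra q
    ... | y , LS | z , LT = meet (IsMIS.dominating (proj₁ (fam p)) z∉S)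
      where
      z∈T : z ∈ˢ T
      z∈T = from LT (here refl)
      z∉S : ¬ z ∈ˢ S
      z∉S z∈S with to LS z∈S
      ... | here refl = S≢T (∈ˢ-ext (λ v → from LT ∘ to LS) (λ v → from LS ∘ to LT))
      ... | there z∈R with z∉R ∷ _ ← unique LT = All.lookup z∉R z∈R refl
      meet : (∃ λ u → u ∈ˢ S × u ~ z) → y ~ z
      meet (u , u∈S , uz) with to LS u∈S
      ... | here refl = uz
      ... | there u∈R = ⊥-elim (nonadjacent (proj₁ (fam q)) (proj₂ (proj₂ (fam q)) u∈R) z∈T uz)

-- Triples

-- The sets of 𝓕 are B together with three more elements: B = [] is the case k = 3, and B = [ x ] treats
-- the sets of size 4 through x.

module Triples {n : ℕ} (A : Adj n) (graph : IsGraph A) (tri : TriangleFree A)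
  (B : List (Fin n)) (uB : Unique B) (𝓕 : List (Subset n)) (u𝓕 : Unique 𝓕)
  (fam : ∀ {S} → S ∈ 𝓕 → IsMIS A S × ∣ S ∣ ≡ 3 + length B × (∀ {v} → v ∈ B → v ∈ˢ S)) where

  open TriangleFreeGraph A graph tri

  -- The elements outside `B` of one set of the family, in a chosen order: later arguments give the
  -- three positions different roles, and `rotate` and `swap` exchange them.
  record Triple (x y z : Fin n) : Set where
    field
      set   : Subset n
      ∈𝓕    : set ∈ 𝓕
      x∈    : x ∈ˢ set
      y∈    : y ∈ˢ set
      z∈    : z ∈ˢ set
      x∉B   : x ∉ B
      y∉B   : y ∉ B
      z∉B   : z ∉ B
      x≢y   : x ≢ y
      y≢z   : y ≢ z
      x≢z   : x ≢ z
      cover : ∀ {v} → v ∈ˢ set → v ∉ B → v ≡ x ⊎ v ≡ y ⊎ v ≡ z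

    apart : ∀ {u v} → u ∈ˢ set → v ∈ˢ set → ¬ u ~ v
    apart = nonadjacent (proj₁ (fam ∈𝓕))

  open Triple

  rotate : ∀ {x y z} → Triple x y z → Triple y z x
  rotate T = record
    { set = set T ; ∈𝓕 = ∈𝓕 T ; x∈ = y∈ T ; y∈ = z∈ T ; z∈ = x∈ T
    ; x∉B = y∉B T ; y∉B = z∉B T ; z∉B = x∉B T ; x≢y = y≢z T ; y≢z = x≢z T ∘ sym ; x≢z = x≢y T ∘ sym
    ; cover = λ v∈ v∉B → case cover T v∈ v∉B of λ
        { (inj₁ e) → inj₂ (inj₂ e) ; (inj₂ (inj₁ e)) → inj₁ e ; (inj₂ (inj₂ e)) → inj₂ (inj₁ e) } }

  swap : ∀ {x y z} → Triple x y z → Triple x z y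
  swap T = record
    { set = set T ; ∈𝓕 = ∈𝓕 T ; x∈ = x∈ T ; y∈ = z∈ T ; z∈ = y∈ T
    ; x∉B = x∉B T ; y∉B = z∉B T ; z∉B = y∉B T ; x≢y = x≢z T ; y≢z = y≢z T ∘ sym ; x≢z = x≢y T
    ; cover = λ v∈ v∉B → case cover T v∈ v∉B of λ
        { (inj₁ e) → inj₁ e ; (inj₂ (inj₁ e)) → inj₂ (inj₂ e) ; (inj₂ (inj₂ e)) → inj₂ (inj₁ e) } }

  -- The set of `T` is independent and contains both `v` and `B`, so no vertex of `B` is adjacent to
  -- `v`. Hence the neighbour of `v` in the set of `Q` is one of `x`, `y`, `z`.
  dominated : ∀ {x y z x′ y′ z′} → Triple x y z → (T : Triple x′ y′ z′) →
              ∀ {v} → v ∈ˢ set T → v ∉ B → v ≢ x → v ≢ y → v ≢ z → x ~ v ⊎ y ~ v ⊎ z ~ v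
  dominated Q T {v} v∈T v∉B v≢x v≢y v≢z
    with u , u∈ , uv ← IsMIS.dominating (proj₁ (fam (∈𝓕 Q)))
           (λ v∈ → case cover Q v∈ v∉B of λ
             { (inj₁ e) → v≢x e ; (inj₂ (inj₁ e)) → v≢y e ; (inj₂ (inj₂ e)) → v≢z e })
    with u ∈? B
  ... | yes u∈B = ⊥-elim (apart T (proj₂ (proj₂ (fam (∈𝓕 T))) u∈B) v∈T uv)
  ... | no u∉B with cover Q u∈ u∉B
  ... | inj₁ refl = inj₁ uv
  ... | inj₂ (inj₁ refl) = inj₂ (inj₁ uv)
  ... | inj₂ (inj₂ refl) = inj₂ (inj₂ uv)

  triple-at : ∀ {S x} → S ∈ 𝓕 → x ∈ˢ S → x ∉ B → ∃ λ u → ∃ λ v → Σ (Triple x u v) λ T → set T ≡ S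
  triple-at {S} {x} S∈ x∈S x∉B with _ , size , B⊆ ← fam S∈
    with zs , L ← complete {S = S} {x ∷ B} (All.tabulate (λ b∈ e → x∉B (subst (_∈ B) (sym e) b∈)) ∷ uB)
                    (λ { (here refl) → x∈S ; (there b∈) → B⊆ b∈ })
    with ℕ.+-cancelʳ-≡ (suc (length B)) (length zs) 2
           (trans (sym (List.length-++ zs)) (trans (lists-length L) size))
  ... | two with u ∷ v ∷ [] ← zs with (u≢v ∷ u≢x ∷ u∉) ∷ (v≢x ∷ v∉) ∷ _ ← unique L = u , v , record
    { set = S ; ∈𝓕 = S∈ ; x∈ = x∈S ; y∈ = from L (here refl) ; z∈ = from L (there (here refl))
    ; x∉B = x∉B ; y∉B = λ b → All.lookup u∉ b refl ; z∉B = λ b → All.lookup v∉ b refl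
    ; x≢y = u≢x ∘ sym ; y≢z = u≢v ; x≢z = v≢x ∘ sym
    ; cover = λ w∈ w∉B → case to L w∈ of λ
        { (here e) → inj₂ (inj₁ e) ; (there (here e)) → inj₂ (inj₂ e)
        ; (there (there (here e))) → inj₁ e ; (there (there (there b))) → ⊥-elim (w∉B b) } } , refl

  codeg≤2 : ∀ {x y} → x ≢ y → x ∉ B → y ∉ B → deg (star 𝓕 x) y ≤ 2
  codeg≤2 {x} {y} x≢y x∉B y∉B = one-element-extensions (y ∷ x ∷ B)
    (star-unique (star-unique u𝓕 x) y)
    ((x≢y ∘ sym ∷ All.tabulate (λ b e → y∉B (subst (_∈ B) (sym e) b)))
      ∷ All.tabulate (λ b e → x∉B (subst (_∈ B) (sym e) b)) ∷ uB)
    λ S∈ → let S∈star , y∈S = star⁻ (star 𝓕 x) y S∈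
               S∈𝓕 , x∈S = star⁻ 𝓕 x S∈star
               m , size , B⊆ = fam S∈𝓕
           in m , size , λ { (here refl) → y∈S ; (there (here refl)) → x∈S ; (there (there b)) → B⊆ b }

  -- Four further vertices meet at most 4 · 2 of the sets through x.
  Heavy : Fin n → Set
  Heavy x = 8 < deg 𝓕 x

  record Permitted (x f : Fin n) : Set where
    constructor permitted
    field
      ≢apex : x ≢ f
      ∉base : f ∉ B

  permitted-codeg≤2 : ∀ {x f} → x ∉ B → Permitted x f → deg (star 𝓕 x) f ≤ 2
  permitted-codeg≤2 x∉B (permitted x≢f f∉B) = codeg≤2 x≢f x∉B f∉B

  avoiding-triple : ∀ {x} → x ∉ B → Heavy x → ∀ f₁ f₂ f₃ f₄ →
    Permitted x f₁ → Permitted x f₂ → Permitted x f₃ → Permitted x f₄ →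
    ∃ λ u → ∃ λ v → Σ (Triple x u v) λ T →
      ∀ {w} → w ∈ˢ set T → f₁ ≢ w × f₂ ≢ w × f₃ ≢ w × f₄ ≢ w
  avoiding-triple {x} x∉B heavy f₁ f₂ f₃ f₄ p₁ p₂ p₃ p₄
    with S , S∈ , avoids ← avoiding (star 𝓕 x) (f₁ ∷ f₂ ∷ f₃ ∷ f₄ ∷ []) (star-unique u𝓕 x)
           (λ { (here refl) → permitted-codeg≤2 x∉B p₁ ; (there (here refl)) → permitted-codeg≤2 x∉B p₂
              ; (there (there (here refl))) → permitted-codeg≤2 x∉B p₃ ; (there (there (there (here refl)))) → permitted-codeg≤2 x∉B p₄ })
           heavy
    with u , v , T , refl ← triple-at (proj₁ (star⁻ 𝓕 x S∈)) (proj₂ (star⁻ 𝓕 x S∈)) x∉B =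
    u , v , T , λ w∈ → (λ { refl → avoids (here refl) w∈ }) , (λ { refl → avoids (there (here refl)) w∈ }) ,
      (λ { refl → avoids (there (there (here refl))) w∈ }) ,
      (λ { refl → avoids (there (there (there (here refl)))) w∈ })

  -- If `u` and `v` were both adjacent to `y`, take the vertex `w` among `u′`, `v′` by which `P′`
  -- dominates `y`. In turn `P` dominates `w` by `u` or `v`, and that vertex forms a triangle with
  -- `w` and `y`. The common vertex `x` never dominates, since it lies in all three independent
  -- sets.
  not-both : ∀ {x y z u v u′ v′} → Triple x y z → Triple x u v → Triple x u′ v′ →
             y ≢ u′ → y ≢ v′ → u′ ≢ u → u′ ≢ v → v′ ≢ u → v′ ≢ v → u ~ y → ¬ v ~ y
  not-both {x} {y} {u = u} {v} T P P′ y≢u′ y≢v′ u′≢u u′≢v v′≢u v′≢v uy vy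
    with dominated P′ T (y∈ T) (y∉B T) (x≢y T ∘ sym) y≢u′ y≢v′
  ... | inj₁ xy = apart T (x∈ T) (y∈ T) xy
  ... | inj₂ u′y⊎v′y = case u′y⊎v′y of λ
    { (inj₁ u′y) → not-adjacent (y∈ P′) (y∉B P′) (x≢y P′ ∘ sym) u′≢u u′≢v u′y
    ; (inj₂ v′y) → not-adjacent (z∈ P′) (z∉B P′) (x≢z P′ ∘ sym) v′≢u v′≢v v′y }
    where
    not-adjacent : ∀ {w} → w ∈ˢ set P′ → w ∉ B → w ≢ x → w ≢ u → w ≢ v → ¬ w ~ y
    not-adjacent w∈ w∉B w≢x w≢u w≢v wy with dominated P P′ w∈ w∉B w≢x w≢u w≢v
    ... | inj₁ xw = apart P′ (x∈ P′) w∈ xw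
    ... | inj₂ (inj₁ uw) = no-triangle uw wy uy
    ... | inj₂ (inj₂ vw) = no-triangle vw wy vy

  -- A second triple through `x` in which `y₁` takes the part of `y` and `z₁` that of `z`. The
  -- adjacencies are those between two removed matching edges of a comatching. The vertices `f₁`,
  -- `f₂` are further ones to be kept out of the triple.
  record CrossTriple (x y z f₁ f₂ : Fin n) : Set where
    field
      y₁ z₁  : Fin n
      triple : Triple x y₁ z₁
      avoids : ∀ {w} → w ∈ˢ set triple → y ≢ w × z ≢ w × f₁ ≢ w × f₂ ≢ w
      yz₁    : y ~ z₁
      zy₁    : z ~ y₁
      ¬yy₁   : ¬ y ~ y₁
      ¬zz₁   : ¬ z ~ z₁

  -- A triple `P` on `x`, `u`, `v` dominates `y` by `u` or `v`, and by `not-both` only by one of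
  -- them. The other is then dominated in `T` by neither `x` nor `y`, hence by `z`; a second use of
  -- `not-both` excludes the last edge.
  cross-triple : ∀ {x y z} → Triple x y z → Heavy x → ∀ f₁ f₂ → Permitted x f₁ → Permitted x f₂ →
                 CrossTriple x y z f₁ f₂
  cross-triple {x} {y} {z} T heavy f₁ f₂ p₁ p₂
    with u , v , P , away ← avoiding-triple (x∉B T) heavy y z f₁ f₂
           (permitted (x≢y T) (y∉B T)) (permitted (x≢z T) (z∉B T)) p₁ p₂
    -- `P′` is the third triple through `x` that `not-both` requires, so it has to be disjoint from
    -- `u` and `v` as well as from `y` and `z`.
    with u′ , v′ , P′ , away′ ← avoiding-triple (x∉B T) heavy y z u v
           (permitted (x≢y T) (y∉B T)) (permitted (x≢z T) (z∉B T))
           (permitted (x≢y P) (y∉B P)) (permitted (x≢z P) (z∉B P))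
    with y≢u , z≢u , _ ← away (y∈ P) | y≢v , z≢v , _ ← away (z∈ P)
       | y≢u′ , z≢u′ , u≢u′ , v≢u′ ← away′ (y∈ P′) | y≢v′ , z≢v′ , u≢v′ , v≢v′ ← away′ (z∈ P′) =
    conclude (dominated P T (y∈ T) (y∉B T) (x≢y T ∘ sym) y≢u y≢v)
             (dominated T P (y∈ P) (y∉B P) (x≢y P ∘ sym) (y≢u ∘ sym) (z≢u ∘ sym))
             (dominated T P (z∈ P) (z∉B P) (x≢z P ∘ sym) (y≢v ∘ sym) (z≢v ∘ sym))
    where
    only-one : ∀ {y z} → Triple x y z → y ≢ u′ → y ≢ v′ → u ~ y → ¬ v ~ y
    only-one T y≢u′ y≢v′ =
      not-both T P P′ y≢u′ y≢v′ (u≢u′ ∘ sym) (v≢u′ ∘ sym) (u≢v′ ∘ sym) (v≢v′ ∘ sym)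
    conclude : x ~ y ⊎ u ~ y ⊎ v ~ y → x ~ u ⊎ y ~ u ⊎ z ~ u → x ~ v ⊎ y ~ v ⊎ z ~ v →
               CrossTriple x y z f₁ f₂
    conclude (inj₁ xy) _ _ = ⊥-elim (apart T (x∈ T) (y∈ T) xy)
    conclude (inj₂ (inj₁ uy)) _ (inj₁ xv) = ⊥-elim (apart P (x∈ P) (z∈ P) xv)
    conclude (inj₂ (inj₁ uy)) _ (inj₂ (inj₁ yv)) = ⊥-elim (only-one T y≢u′ y≢v′ uy (~-sym yv))
    conclude (inj₂ (inj₁ uy)) _ (inj₂ (inj₂ zv)) = record
      { y₁ = v ; z₁ = u ; triple = swap P ; avoids = away ; yz₁ = ~-sym uy ; zy₁ = zv
      ; ¬yy₁ = λ yv → only-one T y≢u′ y≢v′ uy (~-sym yv)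
      ; ¬zz₁ = λ zu → only-one (swap T) z≢u′ z≢v′ (~-sym zu) (~-sym zv) }
    conclude (inj₂ (inj₂ vy)) (inj₁ xu) _ = ⊥-elim (apart P (x∈ P) (y∈ P) xu)
    conclude (inj₂ (inj₂ vy)) (inj₂ (inj₁ yu)) _ = ⊥-elim (only-one T y≢u′ y≢v′ (~-sym yu) vy)
    conclude (inj₂ (inj₂ vy)) (inj₂ (inj₂ zu)) _ = record
      { y₁ = u ; z₁ = v ; triple = P ; avoids = away ; yz₁ = ~-sym vy ; zy₁ = zu
      ; ¬yy₁ = λ yu → only-one T y≢u′ y≢v′ (~-sym yu) vy
      ; ¬zz₁ = λ zv → only-one (swap T) z≢u′ z≢v′ (~-sym zu) (~-sym zv) }

  -- Cross triples (x, y₁, z₁), (y, z₂, x₂), (z, x₃, y₃) would produce the triangle z₁ y₃ x₂.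
  no-cross-triples : ∀ {x y z} (X : CrossTriple x y z y z) →
    let open CrossTriple in
    (Y : CrossTriple y z x (y₁ X) (y₁ X)) → ¬ CrossTriple z x y (z₁ X) (y₁ Y)
  no-cross-triples {x} {y} {z} X Y Z = no-triangle z₁y₃ y₃x₂ z₁x₂
    where
    open CrossTriple
    z₁′ = z₁ X ; z₂ = y₁ Y ; x₂ = z₁ Y ; x₃ = y₁ Z ; y₃ = z₁ Z
    z₁y₃ : z₁′ ~ y₃
    -- `Z` dominates `z₁`, but not by `z`, by the pattern of `X`, and not by `x₃`, since `x₃` and
    -- `z₁` are both neighbours of `y`. The other two edges follow from the same argument, rotated.
    z₁y₃ with dominated (triple Z) (triple X) (z∈ (triple X)) (z∉B (triple X))
                (proj₁ (proj₂ (avoids X (z∈ (triple X)))) ∘ sym)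
                (proj₁ (proj₂ (proj₂ (avoids Z (y∈ (triple Z))))))
                (λ e → ¬zz₁ Z (subst (y ~_) e (yz₁ X)))
    ... | inj₁ zz₁ = ⊥-elim (¬zz₁ X zz₁)
    ... | inj₂ (inj₁ x₃z₁) = ⊥-elim (no-triangle (zy₁ Z) x₃z₁ (yz₁ X))
    ... | inj₂ (inj₂ y₃z₁) = ~-sym y₃z₁
    y₃x₂ : y₃ ~ x₂
    y₃x₂ with dominated (triple Y) (triple Z) (z∈ (triple Z)) (z∉B (triple Z))
                (proj₁ (proj₂ (avoids Z (z∈ (triple Z)))) ∘ sym)
                (proj₂ (proj₂ (proj₂ (avoids Z (z∈ (triple Z))))) ∘ sym)
                (λ e → ¬zz₁ Y (subst (x ~_) e (yz₁ Z)))
    ... | inj₁ yy₃ = ⊥-elim (¬zz₁ Z yy₃)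
    ... | inj₂ (inj₁ z₂y₃) = ⊥-elim (no-triangle (zy₁ Y) z₂y₃ (yz₁ Z))
    ... | inj₂ (inj₂ x₂y₃) = ~-sym x₂y₃
    z₁x₂ : z₁′ ~ x₂
    z₁x₂ with dominated (triple X) (triple Y) (z∈ (triple Y)) (z∉B (triple Y))
                (proj₁ (proj₂ (avoids Y (z∈ (triple Y)))) ∘ sym)
                (proj₁ (proj₂ (proj₂ (avoids Y (z∈ (triple Y))))) ∘ sym)
                (λ e → ¬zz₁ X (subst (z ~_) e (yz₁ Y)))
    ... | inj₁ xx₂ = ⊥-elim (¬zz₁ Y xx₂)
    ... | inj₂ (inj₁ y₁x₂) = ⊥-elim (no-triangle (zy₁ X) y₁x₂ (yz₁ Y))
    ... | inj₂ (inj₂ z₁x₂) = z₁x₂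

  -- The triples are chosen one after another: `Y` avoids `y₁`, and `Z` avoids `z₁` and `z₂`, which
  -- are the inequalities that the triangle argument needs. Where fewer than two extra vertices are
  -- to be avoided, a vertex is repeated.
  not-all-heavy : ∀ {x y z} → Triple x y z → Heavy x → Heavy y → ¬ Heavy z
  not-all-heavy {x} {y} {z} T hx hy hz = at-y (cross-triple T hx y z
      (permitted (x≢y T) (y∉B T)) (permitted (x≢z T) (z∉B T)))
    where
    open CrossTriple
    at-z : (X : CrossTriple x y z y z) → ¬ CrossTriple y z x (y₁ X) (y₁ X)
    at-z X Y = no-cross-triples X Y (cross-triple (rotate (rotate T)) hz (z₁ X) (y₁ Y)
      (permitted (proj₁ (proj₂ (avoids X (z∈ (triple X))))) (z∉B (triple X)))
      (permitted (proj₁ (avoids Y (y∈ (triple Y)))) (y∉B (triple Y))))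
    at-y : ¬ CrossTriple x y z y z
    at-y X = at-z X (cross-triple (rotate T) hy (y₁ X) (y₁ X) y₁ᵖ y₁ᵖ)
      where
      y₁ᵖ : Permitted y (y₁ X)
      y₁ᵖ = permitted (proj₁ (avoids X (y∈ (triple X)))) (y∉B (triple X))

  light-element : ∀ {S} → S ∈ 𝓕 → ∃ λ v → v ∈ˢ S × deg 𝓕 v ≤ 8
  light-element {S} S∈ with m , size , B⊆ ← fam S∈
    with zs , L ← complete {S = S} {B} uB B⊆
    with ℕ.+-cancelʳ-≡ (length B) (length zs) 3
           (trans (sym (List.length-++ zs)) (trans (lists-length L) size))
  ... | three with x ∷ _ ← zs
    with x∉ ∷ _ ← unique L
    with y , z , T , refl ← triple-at S∈ (from L (here refl))
                              (λ b → All.lookup x∉ (∈-++⁺ʳ _ b) refl)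
    with deg 𝓕 x ℕ.≤? 8 | deg 𝓕 y ℕ.≤? 8 | deg 𝓕 z ℕ.≤? 8
  ... | yes p | _ | _ = x , x∈ T , p
  ... | _ | yes p | _ = y , y∈ T , p
  ... | _ | _ | yes p = z , z∈ T , p
  ... | no hx | no hy | no hz = ⊥-elim (not-all-heavy T (ℕ.≰⇒> hx) (ℕ.≰⇒> hy) (ℕ.≰⇒> hz))

  length≤8n : length 𝓕 ≤ n * 8
  length≤8n = cover-bound-all 𝓕 u𝓕 light-element

-- Upper bounds for sizes three and four

numMIS-3-bound : ∀ {n} (A : Adj n) → IsGraph A → TriangleFree A → numMIS A 3 ≤ n * 8
numMIS-3-bound A gr tf = subst (_≤ _) (sym (numMIS≡length A 3)) (
  Triples.length≤8n A gr tf [] [] (misSets A 3) (misSets-unique A 3)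
    λ S∈ → let m , s = misSets⇒ gr S∈ in m , s , λ ())

-- The bound for triples, applied to the sets through a vertex, limits every degree to `n * 8`; any
-- element of a set can therefore serve as its witness.
numMIS-4-bound : ∀ {n} (A : Adj n) → IsGraph A → TriangleFree A → numMIS A 4 ≤ n * (n * 8)
numMIS-4-bound {n} A gr tf = subst (_≤ _) (sym (numMIS≡length A 4))
  (cover-bound-all (misSets A 4) (misSets-unique A 4) covered)
  where
  covered : ∀ {S} → S ∈ misSets A 4 → ∃ λ v → v ∈ˢ S × deg (misSets A 4) v ≤ n * 8
  covered {S} S∈ with m , size ← misSets⇒ {A = A} gr S∈
    with elements S | elements-lists S | trans (length-elements S) size
  ... | x ∷ _ | L | _ = x , from L (here refl) ,
    Triples.length≤8n A gr tf (x ∷ []) ([] ∷ []) (star (misSets A 4) x) (star-unique (misSets-unique A 4) x)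
      λ T∈ → let T∈′ , x∈T = star⁻ (misSets A 4) x T∈
                 m′ , size′ = misSets⇒ gr T∈′
             in m′ , size′ , λ { (here refl) → x∈T }

-- Maximal independent pairs

module Pairs {n : ℕ} (A : Adj n) (graph : IsGraph A) (tri : TriangleFree A) where

  open TriangleFreeGraph A graph tri public

  𝓕 : List (Subset n)
  𝓕 = misSets A 2

  u𝓕 : Unique 𝓕
  u𝓕 = misSets-unique A 2

  apart : ∀ {S u v} → S ∈ 𝓕 → u ∈ˢ S → v ∈ˢ S → ¬ u ~ v
  apart S∈ = nonadjacent (proj₁ (misSets⇒ {A = A} graph S∈))

  record Pair (S : Subset n) (x y : Fin n) : Set where
    field
      ∈𝓕    : S ∈ 𝓕
      x∈    : x ∈ˢ S
      y∈    : y ∈ˢ S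
      x≢y   : x ≢ y
      cover : ∀ {v} → v ∈ˢ S → v ≡ x ⊎ v ≡ y

    dominated : ∀ {v} → v ≢ x → v ≢ y → x ~ v ⊎ y ~ v
    dominated v≢x v≢y
      with u , u∈ , uv ← IsMIS.dominating (proj₁ (misSets⇒ {A = A} graph ∈𝓕))
             (λ v∈ → case cover v∈ of λ { (inj₁ e) → v≢x e ; (inj₂ e) → v≢y e })
      with cover u∈
    ... | inj₁ refl = inj₁ uv
    ... | inj₂ refl = inj₂ uv

  open Pair

  flip : ∀ {S x y} → Pair S x y → Pair S y x
  flip P = record
    { ∈𝓕 = ∈𝓕 P ; x∈ = y∈ P ; y∈ = x∈ P ; x≢y = x≢y P ∘ sym
    ; cover = λ v∈ → case cover P v∈ of λ { (inj₁ e) → inj₂ e ; (inj₂ e) → inj₁ e } }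

  pair-at : ∀ {S x} → S ∈ 𝓕 → x ∈ˢ S → ∃ λ y → Pair S x y
  pair-at {S} {x} S∈ x∈S
    with zs , L ← complete {S = S} {x ∷ []} ([] ∷ []) (λ { (here refl) → x∈S })
    with ℕ.+-cancelʳ-≡ 1 (length zs) 1 (trans (sym (List.length-++ zs))
           (trans (lists-length L) (proj₂ (misSets⇒ {A = A} graph S∈))))
  ... | one with y ∷ [] ← zs with (y≢x ∷ []) ∷ _ ← unique L = y , record
    { ∈𝓕 = S∈ ; x∈ = x∈S ; y∈ = from L (here refl) ; x≢y = y≢x ∘ sym
    ; cover = λ v∈ → case to L v∈ of λ { (here e) → inj₂ e ; (there (here e)) → inj₁ e } }

  some-pair : ∀ {S} → S ∈ 𝓕 → ∃ λ x → ∃ λ y → Pair S x y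
  some-pair {S} S∈ with elements S | elements-lists S
                      | trans (length-elements S) (proj₂ (misSets⇒ {A = A} graph S∈))
  ... | x ∷ _ | L | _ = x , pair-at S∈ (from L (here refl))

  same-pair : ∀ {S T x y} → Pair S x y → Pair T x y → S ≡ T
  same-pair {S} {T} P Q = ∈ˢ-ext (λ v → into P Q) (λ v → into Q P)
    where
    into : ∀ {S T x y v} → Pair S x y → Pair T x y → v ∈ˢ S → v ∈ˢ T
    into P Q v∈ with cover P v∈
    ... | inj₁ refl = x∈ Q
    ... | inj₂ refl = y∈ Q

  deg≤2 : ∀ x → deg 𝓕 x ≤ 2
  deg≤2 x = one-element-extensions (x ∷ []) (star-unique u𝓕 x) ([] ∷ [])
    λ S∈ → let S∈𝓕 , x∈S = star⁻ 𝓕 x S∈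
               m , size = misSets⇒ {A = A} graph S∈𝓕
           in m , size , λ { (here refl) → x∈S }

  two-sets-at : ∀ {u} → 2 ≤ deg 𝓕 u → ∃ λ S → ∃ λ T → S ≢ T × (S ∈ 𝓕 × u ∈ˢ S) × (T ∈ 𝓕 × u ∈ˢ T)
  two-sets-at {u} d with S , T , (S∈ , T∈) , S≢T ← Unique-two (star-unique u𝓕 u) d =
    S , T , S≢T , star⁻ 𝓕 u S∈ , star⁻ 𝓕 u T∈

  another-set : ∀ {u} → 2 ≤ deg 𝓕 u → ∀ S → ∃ λ T → S ≢ T × T ∈ 𝓕 × u ∈ˢ T
  another-set d S with P , Q , P≢Q , p , q ← two-sets-at d with Vec.≡-dec 𝔹._≟_ S P
  ... | no S≢P = P , S≢P , p
  ... | yes refl = Q , P≢Q , q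

  module TwoPairs (n≥6 : 6 ≤ n) {S T : Subset n} {u v w : Fin n}
    (P : Pair S u v) (Q : Pair T u w) (v≢w : v ≢ w) where

    v~w : v ~ w
    v~w with dominated Q (x≢y P ∘ sym) v≢w
    ... | inj₁ uv = ⊥-elim (apart (∈𝓕 P) (x∈ P) (y∈ P) uv)
    ... | inj₂ wv = ~-sym wv

    -- If `u` were not adjacent to `t`, both pairs would dominate `t` by their other ends, and `v`,
    -- `w`, `t` would form a triangle.
    others-adjacent : ∀ {t} → t ≢ u → t ≢ v → t ≢ w → u ~ t
    others-adjacent t≢u t≢v t≢w with dominated P t≢u t≢v | dominated Q t≢u t≢w
    ... | inj₁ ut | _ = ut
    ... | _ | inj₁ ut = ut
    ... | inj₂ vt | inj₂ wt = ⊥-elim (no-triangle v~w wt vt)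

    -- Five vertices are to be avoided, whence the hypothesis `6 ≤ n`.
    outside : ∀ s t → ∃ λ r → r ≢ u × r ≢ v × r ≢ w × r ≢ s × r ≢ t
    outside s t with r , r∉ ← fresh (u ∷ v ∷ w ∷ s ∷ t ∷ []) n≥6 =
      r , (λ e → r∉ (here e)) , (λ e → r∉ (there (here e))) , (λ e → r∉ (there (there (here e)))) ,
      (λ e → r∉ (there (there (there (here e))))) , λ e → r∉ (there (there (there (there (here e)))))

    -- Suppose `R` avoids `v` and `w`. If it contains `u`, its other end is a neighbour of `u`. If
    -- not, both ends are neighbours of `u`, and so is an outside vertex `r`; the end that dominates
    -- `r` completes a triangle with `u`.
    meets : ∀ {R} → R ∈ 𝓕 → ¬ v ∈ˢ R → w ∈ˢ R
    meets {R} R∈ v∉ with w ∈ˢ? R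
    ... | yes w∈ = w∈
    ... | no w∉ with s , t , O ← some-pair R∈ = ⊥-elim (missed O)
      where
      not-v : ∀ {x} → x ∈ˢ R → x ≢ v
      not-v x∈ refl = v∉ x∈
      not-w : ∀ {x} → x ∈ˢ R → x ≢ w
      not-w x∈ refl = w∉ x∈
      missed : ∀ {s t} → ¬ Pair R s t
      missed {s} {t} O with s Fin.≟ u | t Fin.≟ u
      ... | yes refl | _ = apart R∈ (x∈ O) (y∈ O)
              (others-adjacent (x≢y O ∘ sym) (not-v (y∈ O)) (not-w (y∈ O)))
      ... | _ | yes refl = apart R∈ (y∈ O) (x∈ O)
              (others-adjacent (x≢y O) (not-v (x∈ O)) (not-w (x∈ O)))
      ... | no s≢u | no t≢u with r , r≢u , r≢v , r≢w , r≢s , r≢t ← outside s t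
              with dominated O r≢s r≢t | others-adjacent r≢u r≢v r≢w
      ... | inj₁ sr | ur = no-triangle (others-adjacent s≢u (not-v (x∈ O)) (not-w (x∈ O))) sr ur
      ... | inj₂ tr | ur = no-triangle (others-adjacent t≢u (not-v (y∈ O)) (not-w (y∈ O))) tr ur

    -- The new partners `s` of `v` and `t` of `w` are neighbours of `u`, as is an outside vertex
    -- `r`, so neither `s` nor `t` dominates `r`. Then `v` and `w` both do, against `v~w`.
    not-both-two : 2 ≤ deg 𝓕 v → ¬ 2 ≤ deg 𝓕 w
    not-both-two dv dw
      with S′ , S≢S′ , S′∈ , v∈ ← another-set dv S | T′ , T≢T′ , T′∈ , w∈ ← another-set dw T
      with s , P′ ← pair-at S′∈ v∈ | t , Q′ ← pair-at T′∈ w∈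
      with r , r≢u , r≢v , r≢w , r≢s , r≢t ← outside s t =
      contradict (dominated P′ r≢v r≢s) (dominated Q′ r≢w r≢t)
      where
      ur = others-adjacent r≢u r≢v r≢w
      us : u ~ s
      us = others-adjacent (λ { refl → S≢S′ (same-pair P (flip P′)) }) (x≢y P′ ∘ sym)
                           (λ { refl → apart S′∈ (x∈ P′) (y∈ P′) v~w })
      ut : u ~ t
      ut = others-adjacent (λ { refl → T≢T′ (same-pair Q (flip Q′)) })
                           (λ { refl → apart T′∈ (y∈ Q′) (x∈ Q′) v~w }) (x≢y Q′ ∘ sym)
      contradict : v ~ r ⊎ s ~ r → w ~ r ⊎ t ~ r → ⊥
      contradict (inj₁ vr) (inj₁ wr) = no-triangle v~w wr vr
      contradict (inj₂ sr) _ = no-triangle us sr ur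
      contradict _ (inj₂ tr) = no-triangle ut tr ur

    -- Every pair contains `v` or `w`, and of these two vertices at most one lies in two pairs.
    length≤3 : length 𝓕 ≤ 3
    length≤3 = ℕ.≤-trans (ℕ.≤-reflexive (length-split 𝓕 v)) (ℕ.≤-trans (ℕ.+-monoʳ-≤ (deg 𝓕 v) rest) sum≤3)
      where
      rest : length (without 𝓕 v) ≤ deg 𝓕 w
      rest = unique-⊆-length (without-unique u𝓕 v)
        λ R∈ → let R∈𝓕 , v∉ = without⁻ 𝓕 v R∈ in ∈-filter⁺ (w ∈ˢ?_) R∈𝓕 (meets R∈𝓕 v∉)
      sum≤3 : deg 𝓕 v + deg 𝓕 w ≤ 3
      sum≤3 with deg 𝓕 v ℕ.≤? 1 | deg 𝓕 w ℕ.≤? 1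
      ... | yes dv | _ = ℕ.+-mono-≤ dv (deg≤2 w)
      ... | _ | yes dw = ℕ.+-mono-≤ (deg≤2 v) dw
      ... | no dv | no dw = ⊥-elim (not-both-two (ℕ.≰⇒> dv) (ℕ.≰⇒> dw))

  two-at-a-vertex : 6 ≤ n → ∀ {u} → 2 ≤ deg 𝓕 u → length 𝓕 ≤ 3
  two-at-a-vertex n≥6 d with S , T , S≢T , (S∈ , u∈S) , (T∈ , u∈T) ← two-sets-at d
    with v , P ← pair-at S∈ u∈S | w , Q ← pair-at T∈ u∈T =
    TwoPairs.length≤3 n≥6 P Q λ { refl → S≢T (same-pair P Q) }

  Matching : Set
  Matching = ∀ {S T v} → S ∈ 𝓕 → T ∈ 𝓕 → v ∈ˢ S → v ∈ˢ T → S ≡ T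

  deg≤1⇒matching : (∀ v → deg 𝓕 v ≤ 1) → Matching
  deg≤1⇒matching h {v = v} S∈ T∈ v∈S v∈T = length≤1⇒≡ (star-unique u𝓕 v) (h v)
    (∈-filter⁺ (v ∈ˢ?_) S∈ v∈S) (∈-filter⁺ (v ∈ˢ?_) T∈ v∈T)

  record Endpoints (𝓖 : List (Subset n)) : Set where
    field
      vertices : List (Fin n)
      distinct : Unique vertices
      size     : length vertices ≡ length 𝓖 * 2
      sound    : ∀ {v} → v ∈ vertices → ∃ λ S → S ∈ 𝓖 × v ∈ˢ S
      all-in   : ∀ {v S} → S ∈ 𝓖 → v ∈ˢ S → v ∈ vertices

  endpoints : Matching → ∀ 𝓖 → Unique 𝓖 → (∀ {S} → S ∈ 𝓖 → S ∈ 𝓕) → Endpoints 𝓖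
  endpoints matching [] _ _ = record
    { vertices = [] ; distinct = [] ; size = refl ; sound = λ () ; all-in = λ () }
  endpoints matching (S ∷ 𝓖) (S∉ ∷ u) sub = record
    { vertices = elements S ++ E.vertices
    ; distinct = Unique.++⁺ (unique L) E.distinct λ (p , q) →
        let T , T∈ , v∈T = E.sound q in
        All.lookup S∉ T∈ (matching (sub (here refl)) (sub (there T∈)) (from L p) v∈T)
    ; size = trans (List.length-++ (elements S)) (cong₂ _+_
        (trans (length-elements S) (proj₂ (misSets⇒ {A = A} graph (sub (here refl))))) E.size)
    ; sound = λ v∈ → case ∈-++⁻ (elements S) v∈ of λ
        { (inj₁ p) → S , here refl , from L p
        ; (inj₂ q) → let T , T∈ , v∈T = E.sound q in T , there T∈ , v∈T }
    ; all-in = λ { (here refl) v∈ → ∈-++⁺ˡ (to L v∈)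
                 ; (there T∈) v∈ → ∈-++⁺ʳ (elements S) (E.all-in T∈ v∈) } }
    where
    L = elements-lists S
    module E = Endpoints (endpoints matching 𝓖 u (sub ∘ there))

  length≤n/2 : 8 ≤ n → length 𝓕 ≤ n / 2
  length≤n/2 n≥8 with Fin.all? (λ v → deg 𝓕 v ℕ.≤? 1)
  ... | yes h = subst (_≤ n / 2) (DivMod.m*n/n≡m (length 𝓕) 2) (DivMod./-monoˡ-≤ 2
          (subst (_≤ n) E.size (subst (length E.vertices ≤_) (List.length-tabulate (λ (i : Fin n) → i))
            (unique-⊆-length E.distinct λ {v} _ → ∈-allFin v))))
    where module E = Endpoints (endpoints (deg≤1⇒matching h) 𝓕 u𝓕 (λ S∈ → S∈))
  -- A vertex in two pairs leaves at most three, and `3 ≤ 8 / 2 ≤ n / 2`.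
  ... | no ¬h with u , ¬d ← Fin.¬∀⟶∃¬ n (λ v → deg 𝓕 v ≤ 1) (λ v → deg 𝓕 v ℕ.≤? 1) ¬h =
    ℕ.≤-trans (two-at-a-vertex (ℕ.≤-trans (ℕ.m≤m+n 6 2) n≥8) (ℕ.≰⇒> ¬d))
      (ℕ.≤-trans (ℕ.m≤m+n 3 1) (DivMod./-monoˡ-≤ 2 n≥8))

  extremal-matching : 8 ≤ n → length 𝓕 ≡ n / 2 → Matching × (∀ v → deg 𝓕 v ≤ 1)
  extremal-matching n≥8 size = deg≤1⇒matching small , small
    where
    small : ∀ v → deg 𝓕 v ≤ 1
    small v = ℕ.≮⇒≥ λ d → ℕ.<⇒≱ (DivMod./-monoˡ-≤ 2 n≥8)
      (subst (_≤ 3) size (two-at-a-vertex (ℕ.≤-trans (ℕ.m≤m+n 6 2) n≥8) d))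

-- Comatchings and their disjoint unions

-- Vertices below d form the first block and the others the second; in the second block the left
-- part is [d, d + p), in the first it is [0, p).
block : ∀ {n} → ℕ → Fin n → Bool
block d i = ⌊ d ℕ.≤? toℕ i ⌋

side : ∀ {n} → ℕ → ℕ → Fin n → Bool
side d p i = ⌊ toℕ i ℕ.<? (if block d i then d + p else p) ⌋

-- A left vertex receives the number of its partner, `p` places further on. Within a block, vertices
-- on opposite sides are thus partners exactly when their keys agree.
key : ∀ {n} → ℕ → ℕ → Fin n → ℕ
key d p i = if side d p i then toℕ i + p else toℕ i

-- A specification met by `twoBlocks` and, with an empty first block, by `comatching`, so that both
-- share one theory.
record Labelled {n} (A : Adj n) (d p : ℕ) : Set where
  field
    adjacent⇒ : ∀ {i j} → A i j ≡ true → block d i ≡ block d j × side d p i ≢ side d p j × key d p i ≢ key d p j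
    ⇒adjacent : ∀ {i j} → block d i ≡ block d j → side d p i ≢ side d p j → key d p i ≢ key d p j → A i j ≡ true

open Labelled

⌊⌋-true : ∀ {P : Set} (P? : Dec P) → P → ⌊ P? ⌋ ≡ true
⌊⌋-true (yes _) _ = refl
⌊⌋-true (no ¬p) p = ⊥-elim (¬p p)

⌊⌋-false : ∀ {P : Set} (P? : Dec P) → ¬ P → ⌊ P? ⌋ ≡ false
⌊⌋-false (no _) _ = refl
⌊⌋-false (yes p) ¬p = ⊥-elim (¬p p)

true-⌊⌋ : ∀ {P : Set} (P? : Dec P) → ⌊ P? ⌋ ≡ true → P
true-⌊⌋ (yes p) _ = p

twoBlocks? : ∀ {n} d p (i j : Fin n) →
             Dec (block d i ≡ block d j × side d p i ≢ side d p j × key d p i ≢ key d p j)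
twoBlocks? d p i j = (block d i 𝔹.≟ block d j) ×-dec (¬? (side d p i 𝔹.≟ side d p j) ×-dec
                      ¬? (key d p i ℕ.≟ key d p j))

twoBlocks : ∀ {n} → ℕ → ℕ → Adj n
twoBlocks d p i j = ⌊ twoBlocks? d p i j ⌋

twoBlocks-labelled : ∀ {n} d p → Labelled (twoBlocks {n} d p) d p
twoBlocks-labelled d p = record
  { adjacent⇒ = λ {i} {j} → true-⌊⌋ (twoBlocks? d p i j)
  ; ⇒adjacent = λ {i} {j} b s k → ⌊⌋-true (twoBlocks? d p i j) (b , s , k) }

comatching-labelled : ∀ n → Labelled (comatching n) 0 (n / 2)
comatching-labelled n = record
  -- For `d = 0` every vertex lies in the second block, hence `refl`.
  { adjacent⇒ = λ {i} {j} h → let s , k = unfold (inA i) (inA j) (toℕ i) (toℕ j) h in refl , s , k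
  ; ⇒adjacent = λ {i} {j} _ → refold (inA i) (inA j) (toℕ i) (toℕ j) }
  where
  m = n / 2
  edge : Bool → Bool → ℕ → ℕ → Bool
  edge a b x y = (a ∧ not b ∧ not ⌊ x + m ℕ.≟ y ⌋) ∨ (b ∧ not a ∧ not ⌊ y + m ℕ.≟ x ⌋)
  unfold : ∀ a b x y → edge a b x y ≡ true →
           a ≢ b × (if a then x + m else x) ≢ (if b then y + m else y)
  unfold true false x y h with x + m ℕ.≟ y
  ... | no x≢ = (λ ()) , x≢
  unfold false true x y h with y + m ℕ.≟ x
  ... | no y≢ = (λ ()) , y≢ ∘ sym
  refold : ∀ a b x y → a ≢ b → (if a then x + m else x) ≢ (if b then y + m else y) → edge a b x y ≡ true
  refold true true x y s _ = ⊥-elim (s refl)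
  refold false false x y s _ = ⊥-elim (s refl)
  refold true false x y _ k rewrite ⌊⌋-false (x + m ℕ.≟ y) k = refl
  refold false true x y _ k rewrite ⌊⌋-false (y + m ℕ.≟ x) (k ∘ sym) = refl

not-all-different : ∀ {a b c : Bool} → a ≢ b → b ≢ c → ¬ c ≢ a
not-all-different {true} {true} ab _ _ = ab refl
not-all-different {false} {false} ab _ _ = ab refl
not-all-different {true} {false} {true} _ _ ca = ca refl
not-all-different {true} {false} {false} _ bc _ = bc refl
not-all-different {false} {true} {false} _ _ ca = ca refl
not-all-different {false} {true} {true} _ bc _ = bc refl

module LabelledGraph {n} {A : Adj n} {d p} (lab : Labelled A d p) where

  labelled-graph : IsGraph A
  labelled-graph = (λ i j → Bool-ext reverse reverse) ,
    λ i → ¬true⇒false λ h → proj₁ (proj₂ (adjacent⇒ lab h)) refl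
    where
    reverse : ∀ {i j} → A i j ≡ true → A j i ≡ true
    reverse h = let b , s , k = adjacent⇒ lab h in ⇒adjacent lab (sym b) (s ∘ sym) (k ∘ sym)

  labelled-triangleFree : TriangleFree A
  labelled-triangleFree i j k ij jk ki = not-all-different (side≢ ij) (side≢ jk) (side≢ ki)
    where
    side≢ : ∀ {u v} → A u v ≡ true → side d p u ≢ side d p v
    side≢ h = proj₁ (proj₂ (adjacent⇒ lab h))

  key-injective : ∀ {u v : Fin n} → side d p u ≡ side d p v → key d p u ≡ key d p v → u ≡ v
  key-injective {u} {v} s k = Fin.toℕ-injective (cancel (side d p u) (side d p v) s k)
    where
    cancel : ∀ a b → a ≡ b → (if a then toℕ u + p else toℕ u) ≡ (if b then toℕ v + p else toℕ v) → toℕ u ≡ toℕ v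
    cancel true true _ e = ℕ.+-cancelʳ-≡ p _ _ e
    cancel false false _ e = e

  Apart : Fin n → Fin n → Set
  Apart u v = u ≢ v × ¬ A u v ≡ true × ¬ A v u ≡ true

  record Matched (u w : Fin n) : Set where
    field
      same-block : block d u ≡ block d w
      left       : side d p u ≡ true
      right      : side d p w ≡ false
      same-key   : key d p u ≡ key d p w

    apart : Apart u w
    apart = (λ { refl → case trans (sym left) right of λ () }) ,
      (λ h → proj₂ (proj₂ (adjacent⇒ lab h)) same-key) ,
      λ h → proj₂ (proj₂ (adjacent⇒ lab h)) (sym same-key)

    -- A vertex on the side of `u` other than `u` has by `key-injective` a key different from the
    -- one that `u` shares with `w`, so it is adjacent to `w`. On the side of `w` the roles are
    -- exchanged.
    dominates : ∀ v → block d v ≡ block d u → v ≢ u → v ≢ w → A u v ≡ true ⊎ A w v ≡ true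
    dominates v b v≢u v≢w with side d p v in s
    ... | true = inj₂ (⇒adjacent lab (trans (sym same-block) (sym b))
            (λ e → case trans (sym right) (trans e s) of λ ())
            λ e → v≢u (key-injective (trans s (sym left)) (trans (sym e) (sym same-key))))
    ... | false = inj₁ (⇒adjacent lab (sym b)
            (λ e → case trans (sym left) (trans e s) of λ ())
            λ e → v≢w (key-injective (trans s (sym right)) (trans (sym e) same-key)))

  open Matched

  irreflexive : ∀ {v} → ¬ A v v ≡ true
  irreflexive h = proj₁ (proj₂ (adjacent⇒ lab h)) refl

  IsMISList : List (Fin n) → Set
  IsMISList L = Unique L × (∀ {u v} → u ∈ L → v ∈ L → ¬ A u v ≡ true)
              × (∀ {v} → v ∉ L → ∃ λ u → u ∈ L × A u v ≡ true)

  fromList-mis : ∀ {L} → IsMISList L → IsMIS A (fromList L) × ∣ fromList L ∣ ≡ length L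
  fromList-mis (u , ind , dom) = mis (λ p q → ind (to L p) (to L q))
    (λ v∉ → let w , w∈ , wv = dom (v∉ ∘ from L) in w , from L w∈ , wv) , sym (lists-length L)
    where L = fromList-lists u

  apart⇒IsMISList : ∀ {L} → AllPairs Apart L → (∀ {v} → v ∉ L → ∃ λ u → u ∈ L × A u v ≡ true) → IsMISList L
  apart⇒IsMISList ap dom = AllPairs.map proj₁ ap , independent′ ap , dom
    where
    independent′ : ∀ {L u v} → AllPairs Apart L → u ∈ L → v ∈ L → ¬ A u v ≡ true
    independent′ (_ ∷ _) (here refl) (here refl) = irreflexive
    independent′ (a ∷ _) (here refl) (there v∈) = proj₁ (proj₂ (All.lookup a v∈))
    independent′ (a ∷ _) (there u∈) (here refl) = proj₂ (proj₂ (All.lookup a u∈))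
    independent′ (_ ∷ as) (there u∈) (there v∈) = independent′ as u∈ v∈

  many-lists : ∀ {m k} (L : Fin m → List (Fin n)) → (∀ i → IsMISList (L i) × length (L i) ≡ k) →
               (∀ {i j} → (∀ {v} → v ∈ L i → v ∈ L j) → i ≡ j) → m ≤ numMIS A k
  many-lists {m} {k} L good inj = subst₂ _≤_ (List.length-tabulate (fromList ∘ L)) (sym (numMIS≡length A k))
    (unique-⊆-length (Unique.tabulate⁺ injective) members)
    where
    lists-of : ∀ i → Lists (fromList (L i)) (L i)
    lists-of i = fromList-lists (proj₁ (proj₁ (good i)))
    injective : ∀ {i j} → fromList (L i) ≡ fromList (L j) → i ≡ j
    injective {i} {j} e = inj λ v∈ → to (lists-of j) (subst (_ ∈ˢ_) e (from (lists-of i) v∈))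
    members : ∀ {S} → S ∈ tabulate (fromList ∘ L) → S ∈ misSets A k
    members S∈ with i , refl ← ∈-tabulate⁻ {f = fromList ∘ L} S∈ =
      subst (λ l → fromList (L i) ∈ misSets A l) (trans (proj₂ (fromList-mis (proj₁ (good i)))) (proj₂ (good i)))
        (⇒misSets (proj₁ (fromList-mis (proj₁ (good i)))))

  different-blocks : ∀ {u v} → block d u ≢ block d v → Apart u v
  different-blocks ne = (λ { refl → ne refl }) ,
    (λ h → ne (proj₁ (adjacent⇒ lab h))) , λ h → ne (sym (proj₁ (adjacent⇒ lab h)))

  pair-mis : ∀ {u w} → Matched u w → (∀ v → block d v ≡ block d u) → IsMISList (u ∷ w ∷ [])
  pair-mis {u} {w} M one-block = apart⇒IsMISList ((apart M ∷ []) ∷ [] ∷ []) λ {v} v∉ →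
    case dominates M v (one-block v) (v∉ ∘ here) (v∉ ∘ there ∘ here) of λ
      { (inj₁ uv) → u , here refl , uv ; (inj₂ wv) → w , there (here refl) , wv }

  triple-mis : ∀ {z u w} → Matched u w → block d z ≢ block d u →
               (∀ v → block d v ≡ block d u ⊎ v ≡ z) → IsMISList (z ∷ u ∷ w ∷ [])
  triple-mis {z} {u} {w} M zu cases = apart⇒IsMISList
    ((different-blocks zu ∷ different-blocks zw ∷ []) ∷ (apart M ∷ []) ∷ [] ∷ []) dom
    where
    zw : block d z ≢ block d w
    zw e = zu (trans e (sym (same-block M)))
    dom : ∀ {v} → v ∉ z ∷ u ∷ w ∷ [] → ∃ λ t → t ∈ z ∷ u ∷ w ∷ [] × A t v ≡ true
    dom {v} v∉ with cases v
    ... | inj₂ v≡z = ⊥-elim (v∉ (here v≡z))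
    ... | inj₁ b with dominates M v b (v∉ ∘ there ∘ here) (v∉ ∘ there ∘ there ∘ here)
    ... | inj₁ uv = u , there (here refl) , uv
    ... | inj₂ wv = w , there (there (here refl)) , wv

  quadruple-mis : ∀ {s t u w} → Matched s t → Matched u w → block d s ≢ block d u →
                  (∀ v → block d v ≡ block d u ⊎ block d v ≡ block d s) → IsMISList (s ∷ t ∷ u ∷ w ∷ [])
  quadruple-mis {s} {t} {u} {w} N M su cases = apart⇒IsMISList
    ((apart N ∷ different-blocks su ∷ different-blocks sw ∷ [])
      ∷ (different-blocks tu ∷ different-blocks tw ∷ []) ∷ (apart M ∷ []) ∷ [] ∷ []) dom
    where
    L = s ∷ t ∷ u ∷ w ∷ []
    sw : block d s ≢ block d w
    sw e = su (trans e (sym (same-block M)))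
    tu : block d t ≢ block d u
    tu e = su (trans (same-block N) e)
    tw : block d t ≢ block d w
    tw e = tu (trans e (sym (same-block M)))
    dom : ∀ {v} → v ∉ L → ∃ λ a → a ∈ L × A a v ≡ true
    dom {v} v∉ with cases v
    dom {v} v∉ | inj₁ b with dominates M v b (v∉ ∘ there ∘ there ∘ here) (v∉ ∘ there ∘ there ∘ there ∘ here)
    ... | inj₁ uv = u , there (there (here refl)) , uv
    ... | inj₂ wv = w , there (there (there (here refl))) , wv
    dom {v} v∉ | inj₂ b with dominates N v b (v∉ ∘ here) (v∉ ∘ there ∘ here)
    ... | inj₁ sv = s , here refl , sv
    ... | inj₂ tv = t , there (here refl) , tv

module MatchedPairs {n} {A : Adj n} {d p} (lab : Labelled A d p) (d+2p≤n : d + (p + p) ≤ n) where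

  open LabelledGraph lab public
  open Matched

  block-true : ∀ {v : Fin n} → d ≤ toℕ v → block d v ≡ true
  block-true {v} = ⌊⌋-true (d ℕ.≤? toℕ v)

  block-false : ∀ {v : Fin n} → toℕ v < d → block d v ≡ false
  block-false {v} v< = ⌊⌋-false (d ℕ.≤? toℕ v) (ℕ.<⇒≱ v<)

  side-threshold : ∀ {v : Fin n} {b} → block d v ≡ b → side d p v ≡ ⌊ toℕ v ℕ.<? (if b then d + p else p) ⌋
  side-threshold refl = refl

  key-if : ∀ {v : Fin n} {s} → side d p v ≡ s → key d p v ≡ (if s then toℕ v + p else toℕ v)
  key-if refl = refl

  -- Treats both blocks at once: `e` is the start of the block selected by `b`, and the equation for
  -- the threshold becomes `refl` once `b` is known.
  matched : ∀ {b j} {u w : Fin n} → j < p → block d u ≡ b → block d w ≡ b →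
            (let e = if b then d else 0) → (if b then d + p else p) ≡ e + p →
            toℕ u ≡ e + j → toℕ w ≡ e + p + j → Matched u w
  matched {b} {j} {u} {w} j<p bu bw thr tu tw = record
    { same-block = trans bu (sym bw)
    ; left = left′
    ; right = right′
    ; same-key = trans (key-if left′) (trans (cong (_+ p) tu) (trans
        (trans (ℕ.+-assoc e j p) (trans (cong (e +_) (ℕ.+-comm j p)) (sym (ℕ.+-assoc e p j))))
        (sym (trans (key-if right′) tw)))) }
    where
    e = if b then d else 0
    left′ : side d p u ≡ true
    left′ = trans (side-threshold bu) (⌊⌋-true (toℕ u ℕ.<? _)
      (subst₂ _<_ (sym tu) (sym thr) (ℕ.+-monoʳ-< e j<p)))
    right′ : side d p w ≡ false
    right′ = trans (side-threshold bw) (⌊⌋-false (toℕ w ℕ.<? _)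
      (ℕ.≤⇒≯ (subst₂ _≤_ (sym thr) (sym tw) (ℕ.m≤m+n (e + p) j))))

  private
    bound : ∀ (j : Fin p) → d + p + toℕ j < n
    bound j = ℕ.<-≤-trans (subst (d + p + toℕ j <_) (ℕ.+-assoc d p p) (ℕ.+-monoʳ-< (d + p) (Fin.toℕ<n j))) d+2p≤n

    boundˡ : ∀ (j : Fin p) → d + toℕ j < n
    boundˡ j = ℕ.≤-<-trans (ℕ.+-monoˡ-≤ (toℕ j) (ℕ.m≤m+n d p)) (bound j)

  u w : Fin p → Fin n
  u j = fromℕ< (boundˡ j)
  w j = fromℕ< (bound j)

  toℕ-u : ∀ j → toℕ (u j) ≡ d + toℕ j
  toℕ-u j = Fin.toℕ-fromℕ< (boundˡ j)

  toℕ-w : ∀ j → toℕ (w j) ≡ d + p + toℕ j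
  toℕ-w j = Fin.toℕ-fromℕ< (bound j)

  block-u : ∀ j → block d (u j) ≡ true
  block-u j = block-true (subst (d ≤_) (sym (toℕ-u j)) (ℕ.m≤m+n d _))

  block-w : ∀ j → block d (w j) ≡ true
  block-w j = block-true (subst (d ≤_) (sym (toℕ-w j)) (ℕ.≤-trans (ℕ.m≤m+n d p) (ℕ.m≤m+n (d + p) _)))

  matched-uw : ∀ j → Matched (u j) (w j)
  matched-uw j = matched (Fin.toℕ<n j) (block-u j) (block-w j) refl (toℕ-u j) (toℕ-w j)

  u-injective : ∀ {i j} → u i ≡ u j → i ≡ j
  u-injective {i} {j} e = Fin.toℕ-injective (ℕ.+-cancelˡ-≡ d _ _
    (trans (sym (toℕ-u i)) (trans (cong toℕ e) (toℕ-u j))))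

  u≢w : ∀ {i j} → u i ≢ w j
  u≢w {i} {j} e = case trans (sym (left (matched-uw i))) (trans (cong (side d p) e) (right (matched-uw j))) of λ ()

-- Lower bounds from explicit graphs

comatching-numMIS : ∀ n → n / 2 ≤ numMIS (comatching n) 2
comatching-numMIS n = many-lists (λ j → u j ∷ w j ∷ [])
  (λ j → pair-mis (matched-uw j) (λ _ → refl) , refl)
  (λ sub → case sub (here refl) of λ
    { (here e) → u-injective e ; (there (here e)) → ⊥-elim (u≢w e) })
  where
  open MatchedPairs (comatching-labelled n)
    (subst (_≤ n) (trans (ℕ.*-comm (n / 2) 2) (cong (n / 2 +_) (ℕ.+-identityʳ (n / 2)))) (DivMod.m/n*n≤m n 2))

-- For `d = 1` the vertex `zero` is a block by itself, hence isolated, and it extends each maximal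
-- independent pair of the other block to a triple.
isolated+comatching-numMIS : ∀ {n} p → 1 + (p + p) ≤ n → p ≤ numMIS (twoBlocks {n} 1 p) 3
isolated+comatching-numMIS {suc n} p fits = many-lists (λ j → zero ∷ u j ∷ w j ∷ [])
  (λ j → triple-mis (matched-uw j) (zu {j}) (λ { zero → inj₂ refl ; (suc v) → inj₁ refl }) , refl)
  (λ sub → case sub (there (here refl)) of λ
    { (here ()) ; (there (here e)) → u-injective e ; (there (there (here e))) → ⊥-elim (u≢w e) })
  where
  open MatchedPairs (twoBlocks-labelled {suc n} 1 p) fits
  zu : ∀ {j} → block 1 (zero {n}) ≢ block 1 (u j)
  zu {j} e = case trans e (block-u j) of λ ()

-- For `d = p + p` both blocks contain `p` matched pairs, and one pair from each block gives a set
-- of size four. The choices are numbered by `Fin (p * p)` through `remQuot`.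
two-comatchings-numMIS : ∀ {n} p → (p + p) + (p + p) ≤ n → p * p ≤ numMIS (twoBlocks {n} (p + p) p) 4
two-comatchings-numMIS {n} p fits = many-lists L
  (λ i → quadruple-mis (matched-st (k i)) (matched-uw (j i)) (s≢u (k i) (j i)) (cases (k i) (j i)) , refl)
  λ {i} {i′} sub → trans (sym (Fin.combine-remQuot {p} p i)) (trans
    (cong₂ combine (j-determined (sub (there (there (here refl))))) (k-determined (sub (here refl))))
    (Fin.combine-remQuot {p} p i′))
  where
  open MatchedPairs (twoBlocks-labelled {n} (p + p) p) fits
  open Matched
  j k : Fin (p * p) → Fin p
  j = proj₁ ∘ remQuot {p} p
  k = proj₂ ∘ remQuot {p} p
  bound-t : ∀ (i : Fin p) → p + toℕ i < p + p
  bound-t i = ℕ.+-monoʳ-< p (Fin.toℕ<n i)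
  bound-s : ∀ (i : Fin p) → toℕ i < p + p
  bound-s i = ℕ.≤-<-trans (ℕ.m≤n+m _ p) (bound-t i)
  small : ∀ {x} → x < p + p → x < n
  small x< = ℕ.<-≤-trans x< (ℕ.≤-trans (ℕ.m≤m+n (p + p) _) fits)
  s t : Fin p → Fin n
  s i = fromℕ< (small (bound-s i))
  t i = fromℕ< (small (bound-t i))
  toℕ-s : ∀ i → toℕ (s i) ≡ toℕ i
  toℕ-s i = Fin.toℕ-fromℕ< (small (bound-s i))
  toℕ-t : ∀ i → toℕ (t i) ≡ p + toℕ i
  toℕ-t i = Fin.toℕ-fromℕ< (small (bound-t i))
  block-s : ∀ i → block (p + p) (s i) ≡ false
  block-s i = block-false (subst (_< p + p) (sym (toℕ-s i)) (bound-s i))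
  block-t : ∀ i → block (p + p) (t i) ≡ false
  block-t i = block-false (subst (_< p + p) (sym (toℕ-t i)) (bound-t i))
  matched-st : ∀ i → Matched (s i) (t i)
  matched-st i = matched (Fin.toℕ<n i) (block-s i) (block-t i) refl (toℕ-s i) (toℕ-t i)
  s≢u : ∀ i i′ → block (p + p) (s i) ≢ block (p + p) (u i′)
  s≢u i i′ e = case trans (sym (block-s i)) (trans e (block-u i′)) of λ ()
  t≢u : ∀ i i′ → block (p + p) (t i) ≢ block (p + p) (u i′)
  t≢u i i′ e = case trans (sym (block-t i)) (trans e (block-u i′)) of λ ()
  s≢w : ∀ i i′ → block (p + p) (s i) ≢ block (p + p) (w i′)
  s≢w i i′ e = case trans (sym (block-s i)) (trans e (block-w i′)) of λ ()
  cases : ∀ i i′ v → block (p + p) v ≡ block (p + p) (u i′) ⊎ block (p + p) v ≡ block (p + p) (s i)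
  cases i i′ v with block (p + p) v
  ... | true = inj₁ (sym (block-u i′))
  ... | false = inj₂ (sym (block-s i))
  L : Fin (p * p) → List (Fin n)
  L i = s (k i) ∷ t (k i) ∷ u (j i) ∷ w (j i) ∷ []
  s-injective : ∀ {i i′} → s i ≡ s i′ → i ≡ i′
  s-injective {i} {i′} e = Fin.toℕ-injective (trans (sym (toℕ-s i)) (trans (cong toℕ e) (toℕ-s i′)))
  k-determined : ∀ {i i′} → s (k i) ∈ L i′ → k i ≡ k i′
  k-determined (here e) = s-injective e
  k-determined {i} {i′} (there (here e)) = case trans (sym (left (matched-st (k i))))
    (trans (cong (side (p + p) p) e) (right (matched-st (k i′)))) of λ ()
  k-determined {i} {i′} (there (there (here e))) = ⊥-elim (s≢u (k i) (j i′) (cong (block (p + p)) e))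
  k-determined {i} {i′} (there (there (there (here e)))) = ⊥-elim (s≢w (k i) (j i′) (cong (block (p + p)) e))
  j-determined : ∀ {i i′} → u (j i) ∈ L i′ → j i ≡ j i′
  j-determined {i} {i′} (here e) = ⊥-elim (s≢u (k i′) (j i) (cong (block (p + p)) (sym e)))
  j-determined {i} {i′} (there (here e)) = ⊥-elim (t≢u (k i′) (j i) (cong (block (p + p)) (sym e)))
  j-determined (there (there (here e))) = u-injective e
  j-determined (there (there (there (here e)))) = ⊥-elim (u≢w e)

-- Extremal graphs for pairs

nth-injective : ∀ {X : Set} {xs : List X} → Unique xs → ∀ {i j} → nth xs i ≡ nth xs j → i ≡ j
nth-injective {xs = _ ∷ _} _ {zero} {zero} _ = refl
nth-injective {xs = _ ∷ xs} (x∉ ∷ _) {zero} {suc j} e = ⊥-elim (All.lookup x∉ (∈-lookup {xs = xs} j) e)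
nth-injective {xs = _ ∷ xs} (x∉ ∷ _) {suc i} {zero} e = ⊥-elim (All.lookup x∉ (∈-lookup {xs = xs} i) (sym e))
nth-injective {xs = _ ∷ _} (_ ∷ u) {suc i} {suc j} e = cong suc (nth-injective u e)

-- A value `y` without preimage would form, together with the `n` values of `f`, a list of `n + 1`
-- distinct elements of `Fin n`.
injective⇒right-inverse : ∀ {n} (f : Fin n → Fin n) → (∀ {i j} → f i ≡ f j → i ≡ j) →
                          ∃ λ g → ∀ y → f (g y) ≡ y
injective⇒right-inverse {n} f inj = proj₁ ∘ preimage , proj₂ ∘ preimage
  where
  preimage : ∀ y → ∃ λ x → f x ≡ y
  preimage y with Fin.any? (λ x → f x Fin.≟ y)
  ... | yes w = w
  ... | no none = ⊥-elim (ℕ.1+n≰n (subst₂ _≤_ (cong suc (List.length-tabulate f)) (List.length-tabulate (λ (i : Fin n) → i))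
    (unique-⊆-length (All.tabulate (λ z∈ e → let i , z≡ = ∈-tabulate⁻ {f = f} z∈ in none (i , sym (trans e z≡)))
                       ∷ Unique.tabulate⁺ inj) λ {v} _ → ∈-allFin v)))

module Extremal {n : ℕ} (A : Adj n) (graph : IsGraph A) (tri : TriangleFree A) (n≥8 : 8 ≤ n)
  (size : length (misSets A 2) ≡ n / 2) where

  open Pairs A graph tri
  open Pair

  abstract
    matching : Matching
    matching = proj₁ (extremal-matching n≥8 size)

    length≥4 : 4 ≤ length 𝓕
    length≥4 = subst (4 ≤_) (sym size) (DivMod./-monoˡ-≤ 2 n≥8)

    -- Each vertex lies in at most one pair, so three vertices meet at most three of the at least
    -- four pairs.
    avoiding-three : ∀ u v w → ∃ λ S → S ∈ 𝓕 × (∀ {f} → f ∈ u ∷ v ∷ w ∷ [] → ¬ f ∈ˢ S)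
    avoiding-three u v w = avoiding {C = 1} 𝓕 (u ∷ v ∷ w ∷ []) u𝓕
      (λ {f} _ → proj₂ (extremal-matching n≥8 size) f) length≥4

    some-set : ∃ λ S → S ∈ 𝓕
    some-set = let S , S∈ , _ = avoiding {C = 0} 𝓕 [] u𝓕 (λ ()) (ℕ.≤-trans (s≤s z≤n) length≥4) in S , S∈

  -- A third pair avoiding v, a and b has an end adjacent to v, and that end is adjacent to a or b.
  no-common-neighbour : ∀ {S a b v} → Pair S a b → a ~ v → ¬ b ~ v
  no-common-neighbour {S} {a} {b} {v} P av bv
    with T , T∈ , avoids ← avoiding-three v a b
    with c , d , Q ← some-pair T∈ = ends (dominated Q (out (here refl) (x∈ Q)) (out (here refl) (y∈ Q)))
    where
    out : ∀ {f w} → f ∈ v ∷ a ∷ b ∷ [] → w ∈ˢ T → f ≢ w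
    out f∈ w∈ refl = avoids f∈ w∈
    end : ∀ {w} → w ∈ˢ T → ¬ w ~ v
    end w∈ wv with dominated P (out (there (here refl)) w∈ ∘ sym) (out (there (there (here refl))) w∈ ∘ sym)
    ... | inj₁ aw = no-triangle aw wv av
    ... | inj₂ bw = no-triangle bw wv bv
    ends : c ~ v ⊎ d ~ v → ⊥
    ends (inj₁ cv) = end (x∈ Q) cv
    ends (inj₂ dv) = end (y∈ Q) dv

  -- The set of `a` and the neighbours of `b`. For a pair on `a` and `b`, this set and `Side b a`
  -- will be the two parts of the bipartition.
  Side : Fin n → Fin n → Fin n → Set
  Side a b v = v ≡ a ⊎ b ~ v

  side-split : ∀ {S a b} → Pair S a b → ∀ v → Side a b v ⊎ Side b a v
  side-split {a = a} {b} P v with v Fin.≟ a | v Fin.≟ b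
  ... | yes e | _ = inj₁ (inj₁ e)
  ... | _ | yes e = inj₂ (inj₁ e)
  ... | no v≢a | no v≢b with dominated P v≢a v≢b
  ... | inj₁ av = inj₂ (inj₂ av)
  ... | inj₂ bv = inj₁ (inj₂ bv)

  side-exclusive : ∀ {S a b v} → Pair S a b → Side a b v → ¬ Side b a v
  side-exclusive P (inj₁ refl) (inj₁ e) = x≢y P e
  side-exclusive P (inj₁ refl) (inj₂ aa) = ~-irrefl aa
  side-exclusive P (inj₂ bb) (inj₁ refl) = ~-irrefl bb
  side-exclusive P (inj₂ bv) (inj₂ av) = no-common-neighbour P av bv

  side-independent : ∀ {S a b u v} → Pair S a b → Side a b u → Side a b v → ¬ u ~ v
  side-independent P (inj₁ refl) (inj₁ refl) uv = ~-irrefl uv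
  side-independent P (inj₁ refl) (inj₂ bv) av = no-common-neighbour P av bv
  side-independent P (inj₂ bu) (inj₁ refl) ua = no-common-neighbour P (~-sym ua) bu
  side-independent P (inj₂ bu) (inj₂ bv) uv = no-triangle bu uv bv

  -- If `T` contains `a`, the matching property makes `T` equal to `S`, whose ends lie on different
  -- sides. Otherwise an end of `T` dominates `a`, and that end cannot share the independent side of
  -- `a`.
  ends-differ : ∀ {S a b T c d} → Pair S a b → Pair T c d → Side a b c → ¬ Side a b d
  ends-differ {a = a} {b} {T} P Q sc sd with a ∈ˢ? T
  ... | yes a∈ with cover Q (subst (b ∈ˢ_) (matching (∈𝓕 P) (∈𝓕 Q) (x∈ P) a∈) (y∈ P))
  ... | inj₁ refl = side-exclusive P sc (inj₁ refl)
  ... | inj₂ refl = side-exclusive P sd (inj₁ refl)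
  ends-differ P Q sc sd | no a∉ with dominated Q (λ { refl → a∉ (x∈ Q) }) (λ { refl → a∉ (y∈ Q) })
  ... | inj₁ ca = side-independent P sc (inj₁ refl) ca
  ... | inj₂ da = side-independent P sd (inj₁ refl) da

  -- If `y` were outside `T`, the partner `x′` of `x` would dominate it. But by `ends-differ` this
  -- partner lies on the side of `y`, which is independent.
  nonneighbour-is-partner : ∀ {S a b T x y} → Pair S a b → T ∈ 𝓕 → x ∈ˢ T → Side a b x → Side b a y →
                            ¬ x ~ y → y ∈ˢ T
  nonneighbour-is-partner {T = T} {x} {y} P T∈ x∈T sx sy ¬xy with y ∈ˢ? T
  ... | yes y∈ = y∈
  ... | no y∉ with x′ , Q ← pair-at T∈ x∈T with dominated Q (λ { refl → y∉ (x∈ Q) }) (λ { refl → y∉ (y∈ Q) })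
  ... | inj₁ xy = ⊥-elim (¬xy xy)
  ... | inj₂ x′y with side-split P x′
  ... | inj₁ sx′ = ⊥-elim (ends-differ P Q sx sx′)
  ... | inj₂ sx′ = ⊥-elim (side-independent (flip P) sx′ sy x′y)

  abstract
    oriented-ends : ∀ {S a b T} → Pair S a b → T ∈ 𝓕 → ∃ λ c → ∃ λ d → Pair T c d × Side a b c × Side b a d
    oriented-ends P T∈ with c , d , Q ← some-pair T∈ with side-split P c | side-split P d
    ... | inj₁ sc | inj₂ sd = c , d , Q , sc , sd
    ... | inj₂ sc | inj₁ sd = d , c , flip Q , sd , sc
    ... | inj₁ sc | inj₁ sd = ⊥-elim (ends-differ P Q sc sd)
    ... | inj₂ sc | inj₂ sd = ⊥-elim (ends-differ (flip P) Q sc sd)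

  -- Numbering the vertices as in the comatching

  m : ℕ
  m = n / 2

  Unmatched : Fin n → Set
  Unmatched e = ∀ {S} → S ∈ 𝓕 → ¬ e ∈ˢ S

  spare-vertex : ∃ λ e → m + m < n → Unmatched e
  spare-vertex with m + m ℕ.<? n
  -- For even `n` there need be no unmatched vertex; an arbitrary one serves as default, and the
  -- implication is vacuous.
  ... | no ¬odd = fromℕ< (ℕ.≤-trans (s≤s z≤n) n≥8) , λ odd → ⊥-elim (¬odd odd)
  ... | yes odd = let e , e∉ = fresh E.vertices (subst (_< n) (sym count) odd)
                  in e , λ _ S∈ e∈ → e∉ (E.all-in S∈ e∈)
    where
    module E = Endpoints (endpoints matching 𝓕 u𝓕 (λ S∈ → S∈))
    count : length E.vertices ≡ m + m
    count = trans E.size (trans (cong (_* 2) size) (trans (ℕ.*-comm m 2) (cong (m +_) (ℕ.+-identityʳ m))))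

  -- The ends of the reference pair are named so that a spare vertex falls on the side of `b`,
  -- because the right part of `comatching` is the larger one for odd `n`.
  record Base (e : Fin n) : Set where
    field
      {S₀}    : Subset n
      a b     : Fin n
      pair    : Pair S₀ a b
      spare-b : Unmatched e → Side b a e

  base : ∀ e → Base e
  base e with S , S∈ ← some-set
    with p , q , P ← some-pair S∈ with A p e 𝔹.≟ true
  ... | yes pe = record { pair = P ; spare-b = λ _ → inj₂ pe }
  ... | no ¬pe = record { pair = flip P ; spare-b = λ un →
          case dominated P (λ { refl → un S∈ (x∈ P) }) (λ { refl → un S∈ (y∈ P) }) of λ
            { (inj₁ pe) → ⊥-elim (¬pe pe) ; (inj₂ qe) → inj₂ qe } }

  module Oriented (e : Fin n) (odd⇒unmatched : m + m < n → Unmatched e)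
    {S₀ : Subset n} {a b : Fin n} (pair : Pair S₀ a b) (spare-b : Unmatched e → Side b a e) where

    Left Right : Fin n → Set
    Left = Side a b
    Right = Side b a

    Ix : Set
    Ix = Fin (length 𝓕)

    member : ∀ (j : Ix) → nth 𝓕 j ∈ 𝓕
    member = ∈-lookup {xs = 𝓕}

    ends : ∀ (j : Ix) → ∃ λ c → ∃ λ d → Pair (nth 𝓕 j) c d × Left c × Right d
    ends j = oriented-ends pair (member j)

    l r : Ix → Fin n
    l j = proj₁ (ends j)
    r j = proj₁ (proj₂ (ends j))

    l∈ : ∀ j → l j ∈ˢ nth 𝓕 j
    l∈ j = x∈ (proj₁ (proj₂ (proj₂ (ends j))))

    r∈ : ∀ j → r j ∈ˢ nth 𝓕 j
    r∈ j = y∈ (proj₁ (proj₂ (proj₂ (ends j))))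

    l-left : ∀ j → Left (l j)
    l-left j = proj₁ (proj₂ (proj₂ (proj₂ (ends j))))

    r-right : ∀ j → Right (r j)
    r-right j = proj₂ (proj₂ (proj₂ (proj₂ (ends j))))

    same-index : ∀ {i j v} → v ∈ˢ nth 𝓕 i → v ∈ˢ nth 𝓕 j → i ≡ j
    same-index {i} {j} p q = nth-injective u𝓕 (matching (member i) (member j) p q)

    -- The positions of `comatching`: left ends below `m`, their partners `m` places later in the
    -- same order, and for odd `n` the last position for the spare vertex.
    data Slot (t : ℕ) : Set where
      left  : (j : Ix) → t ≡ toℕ j → Slot t
      right : (j : Ix) → t ≡ m + toℕ j → Slot t
      spare : m + m ≤ t → Slot t

    slot : ∀ t → Slot t
    slot t with t ℕ.<? m | t ℕ.<? m + m
    ... | yes t<m | _ = left (fromℕ< (subst (t <_) (sym size) t<m)) (sym (Fin.toℕ-fromℕ< _))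
    ... | no t≮m | yes t<2m = right (fromℕ< offset<) (trans (sym (ℕ.m+[n∸m]≡n (ℕ.≮⇒≥ t≮m))) (cong (m +_) (sym (Fin.toℕ-fromℕ< offset<))))
      where
      offset< : t Data.Nat.∸ m < length 𝓕
      offset< = subst (t Data.Nat.∸ m <_) (sym size) (ℕ.+-cancelˡ-< m _ _ (subst (_< m + m) (sym (ℕ.m+[n∸m]≡n (ℕ.≮⇒≥ t≮m))) t<2m))
    ... | no _ | no t≮2m = spare (ℕ.≮⇒≥ t≮2m)

    vertex : ∀ {t} → Slot t → Fin n
    vertex (left j _) = l j
    vertex (right j _) = r j
    vertex (spare _) = e

    toℕ<m : ∀ (j : Ix) → toℕ j < m
    toℕ<m j = subst (toℕ j <_) size (Fin.toℕ<n j)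

    unmatched : ∀ {i : Fin n} → m + m ≤ toℕ i → Unmatched e
    unmatched {i} 2m≤ = odd⇒unmatched (ℕ.≤-<-trans 2m≤ (Fin.toℕ<n i))

    n≤1+2m : n ≤ suc (m + m)
    n≤1+2m = subst₂ _≤_ (sym (DivMod.m≡m%n+[m/n]*n n 2)) (cong suc (trans (ℕ.*-comm m 2) (cong (m +_) (ℕ.+-identityʳ m))))
      (ℕ.+-monoˡ-≤ (m * 2) (ℕ.≤-pred (DivMod.m%n<n n 2)))

    vertex-injective : ∀ {i i′ : Fin n} (s : Slot (toℕ i)) (s′ : Slot (toℕ i′)) → vertex s ≡ vertex s′ → i ≡ i′
    vertex-injective (left j t) (left j′ t′) eq with refl ← same-index (l∈ j) (subst (_∈ˢ nth 𝓕 j′) (sym eq) (l∈ j′)) =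
      Fin.toℕ-injective (trans t (sym t′))
    vertex-injective (right j t) (right j′ t′) eq with refl ← same-index (r∈ j) (subst (_∈ˢ nth 𝓕 j′) (sym eq) (r∈ j′)) =
      Fin.toℕ-injective (trans t (sym t′))
    -- Two spare positions coincide, since `n ≤ suc (m + m)` leaves only the position `m + m`.
    vertex-injective {i} {i′} (spare t) (spare t′) _ = Fin.toℕ-injective (trans (exact i t) (sym (exact i′ t′)))
      where
      exact : ∀ (i : Fin n) → m + m ≤ toℕ i → toℕ i ≡ m + m
      exact i 2m≤ = ℕ.≤-antisym (ℕ.≤-pred (ℕ.≤-trans (Fin.toℕ<n i) n≤1+2m)) 2m≤
    vertex-injective (left j _) (right j′ _) eq = ⊥-elim (side-exclusive pair (l-left j) (subst Right (sym eq) (r-right j′)))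
    vertex-injective (right j _) (left j′ _) eq = ⊥-elim (side-exclusive pair (l-left j′) (subst Right eq (r-right j)))
    vertex-injective {i′ = i′} (left j _) (spare t′) eq = ⊥-elim (unmatched {i′} t′ (member j) (subst (_∈ˢ nth 𝓕 j) eq (l∈ j)))
    vertex-injective {i′ = i′} (right j _) (spare t′) eq = ⊥-elim (unmatched {i′} t′ (member j) (subst (_∈ˢ nth 𝓕 j) eq (r∈ j)))
    vertex-injective {i} (spare t) (left j _) eq = ⊥-elim (unmatched {i} t (member j) (subst (_∈ˢ nth 𝓕 j) (sym eq) (l∈ j)))
    vertex-injective {i} (spare t) (right j _) eq = ⊥-elim (unmatched {i} t (member j) (subst (_∈ˢ nth 𝓕 j) (sym eq) (r∈ j)))

    module C = LabelledGraph (comatching-labelled n)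

    C : Adj n
    C = comatching n

    side-of key-of : Fin n → _
    side-of = side 0 m
    key-of = key 0 m

    left-side : ∀ {i : Fin n} {j : Ix} → toℕ i ≡ toℕ j → side-of i ≡ true
    left-side {i} {j} t = ⌊⌋-true (toℕ i ℕ.<? m) (subst (_< m) (sym t) (toℕ<m j))

    left-key : ∀ {i : Fin n} {j : Ix} → toℕ i ≡ toℕ j → key-of i ≡ m + toℕ j
    left-key {i} {j} t rewrite left-side {i} {j} t = trans (cong (_+ m) t) (ℕ.+-comm (toℕ j) m)

    right-side : ∀ {i : Fin n} → m ≤ toℕ i → side-of i ≡ false
    right-side {i} m≤ = ⌊⌋-false (toℕ i ℕ.<? m) (ℕ.≤⇒≯ m≤)

    right-key : ∀ {i : Fin n} → m ≤ toℕ i → key-of i ≡ toℕ i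
    right-key {i} m≤ rewrite right-side {i} m≤ = refl

    same-side-entry : ∀ {x y} {i i′ : Fin n} → ¬ x ~ y → side-of i ≡ side-of i′ → A x y ≡ C i i′
    same-side-entry ¬xy s = Bool-ext (λ xy → ⊥-elim (¬xy xy))
      (λ h → ⊥-elim (proj₁ (proj₂ (adjacent⇒ (comatching-labelled n) h)) s))

    -- Across the sides, the only non-neighbour of `l j` is its partner, and in `comatching` the
    -- only one of position `toℕ j` is `m + toℕ j`. The last two hypotheses say that these
    -- exceptions correspond.
    cross-entry : ∀ {j y} {i i′ : Fin n} → toℕ i ≡ toℕ j → m ≤ toℕ i′ → Right y →
                  (y ∈ˢ nth 𝓕 j → m + toℕ j ≡ toℕ i′) → (m + toℕ j ≡ toℕ i′ → y ∈ˢ nth 𝓕 j) →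
                  A (l j) y ≡ C i i′
    cross-entry {j} {y} {i} {i′} t m≤ right-y partner⇒ ⇒partner = Bool-ext
      (λ ly → ⇒adjacent (comatching-labelled n) refl
        (λ s → case trans (sym (left-side {i} {j} t)) (trans s (right-side {i′} m≤)) of λ ())
        λ k → apart (member j) (l∈ j)
          (⇒partner (trans (sym (left-key {i} {j} t)) (trans k (right-key {i′} m≤)))) ly)
      λ h → case A (l j) y 𝔹.≟ true of λ
        { (yes ly) → ly
        ; (no ¬ly) → ⊥-elim (proj₂ (proj₂ (adjacent⇒ (comatching-labelled n) h))
            (trans (left-key {i} {j} t) (trans
              (partner⇒ (nonneighbour-is-partner pair (member j) (l∈ j) (l-left j) right-y ¬ly))
              (sym (right-key {i′} m≤))))) }

    m≤right : ∀ {t} {j : Ix} → t ≡ m + toℕ j → m ≤ t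
    m≤right {j = j} t = subst (m ≤_) (sym t) (ℕ.m≤m+n m (toℕ j))

    m≤spare : ∀ {t} → m + m ≤ t → m ≤ t
    m≤spare = ℕ.≤-trans (ℕ.m≤m+n m m)

    left-right-entry : ∀ {i i′ : Fin n} {j j′ : Ix} → toℕ i ≡ toℕ j → toℕ i′ ≡ m + toℕ j′ → A (l j) (r j′) ≡ C i i′
    left-right-entry {i} {i′} {j} {j′} t t′ = cross-entry t (m≤right {j = j′} t′) (r-right j′)
      (λ r∈j → trans (cong (λ k → m + toℕ k) (same-index r∈j (r∈ j′))) (sym t′))
      (λ eq → subst (λ k → r j′ ∈ˢ nth 𝓕 k) (sym (Fin.toℕ-injective (ℕ.+-cancelˡ-≡ m _ _ (trans eq t′)))) (r∈ j′))

    left-spare-entry : ∀ {i i′ : Fin n} {j : Ix} → toℕ i ≡ toℕ j → m + m ≤ toℕ i′ → A (l j) e ≡ C i i′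
    left-spare-entry {i} {i′} {j} t t′ = cross-entry t (m≤spare t′) (spare-b (unmatched {i′} t′))
      (λ e∈ → ⊥-elim (unmatched {i′} t′ (member j) e∈))
      (λ eq → ⊥-elim (ℕ.<⇒≢ (ℕ.<-≤-trans (ℕ.+-monoʳ-< m (toℕ<m j)) t′) eq))

    mirror : ∀ {x y} {i i′ : Fin n} → A y x ≡ C i′ i → A x y ≡ C i i′
    mirror {x} {y} {i} {i′} eq = trans (proj₁ graph x y) (trans eq (proj₁ C.labelled-graph i′ i))

    right-slot : ∀ {i : Fin n} → m ≤ toℕ i → (s : Slot (toℕ i)) → Right (vertex s)
    right-slot m≤ (left j t) = ⊥-elim (ℕ.<⇒≱ (subst (_< m) (sym t) (toℕ<m j)) m≤)
    right-slot m≤ (right j _) = r-right j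
    right-slot {i} m≤ (spare t) = spare-b (unmatched {i} t)

    right-right-entry : ∀ {i i′ : Fin n} → m ≤ toℕ i → m ≤ toℕ i′ → (s : Slot (toℕ i)) (s′ : Slot (toℕ i′)) →
                        A (vertex s) (vertex s′) ≡ C i i′
    right-right-entry {i} {i′} m≤ m≤′ s s′ =
      same-side-entry (side-independent (flip pair) (right-slot m≤ s) (right-slot m≤′ s′))
        (trans (right-side {i} m≤) (sym (right-side {i′} m≤′)))

    entry : ∀ {i i′ : Fin n} (s : Slot (toℕ i)) (s′ : Slot (toℕ i′)) → A (vertex s) (vertex s′) ≡ C i i′
    entry {i} {i′} (left j t) (left j′ t′) = same-side-entry (side-independent pair (l-left j) (l-left j′))
      (trans (left-side {i} {j} t) (sym (left-side {i′} {j′} t′)))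
    entry (left j t) (right j′ t′) = left-right-entry t t′
    entry (left j t) (spare t′) = left-spare-entry t t′
    entry (right j t) (left j′ t′) = mirror (left-right-entry t′ t)
    entry (spare t) (left j′ t′) = mirror (left-spare-entry t′ t)
    entry s@(right j t) s′@(right j′ t′) = right-right-entry (m≤right {j = j} t) (m≤right {j = j′} t′) s s′
    entry s@(right j t) s′@(spare t′) = right-right-entry (m≤right {j = j} t) (m≤spare t′) s s′
    entry s@(spare t) s′@(right j′ t′) = right-right-entry (m≤spare t) (m≤right {j = j′} t′) s s′
    entry s@(spare t) s′@(spare t′) = right-right-entry (m≤spare t) (m≤spare t′) s s′

    σ : Fin n → Fin n
    σ i = vertex (slot (toℕ i))

    σ-injective : ∀ {i i′} → σ i ≡ σ i′ → i ≡ i′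
    σ-injective {i} {i′} = vertex-injective (slot (toℕ i)) (slot (toℕ i′))

    isomorphic : Isomorphic A (comatching n)
    -- `σ` sends positions of `comatching` to vertices of `A`, so the isomorphism from `A` is its
    -- inverse `τ`.
    isomorphic = permutation τ σ (λ i → σ-injective (στ (σ i))) στ , λ x y →
      trans (cong₂ A (sym (στ x)) (sym (στ y))) (entry (slot (toℕ (τ x))) (slot (toℕ (τ y))))
      where
      τ : Fin n → Fin n
      τ = proj₁ (injective⇒right-inverse σ σ-injective)
      στ : ∀ y → σ (τ y) ≡ y
      στ = proj₂ (injective⇒right-inverse σ σ-injective)

  extremal⇒comatching : Isomorphic A (comatching n)
  extremal⇒comatching = Oriented.isomorphic (proj₁ spare-vertex) (proj₂ spare-vertex) pair spare-b
    where open Base (base (proj₁ spare-vertex))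

-- Exact value and uniqueness for pairs, orders of growth for triples and quadruples

theorem1p6 : ((n : ℕ) → n ≥ 8 →
    IsM3 n 2 (n / 2)
    × (IsGraph (comatching n) × TriangleFree (comatching n) × numMIS (comatching n) 2 ≡ n / 2)
    × ((A : Adj n) → IsGraph A → TriangleFree A → numMIS A 2 ≡ n / 2 → Isomorphic A (comatching n)))
    × (Σ ℕ λ c → Σ ℕ λ C → Σ ℕ λ N → (n : ℕ) → n ≥ N → Σ ℕ λ m → IsM3 n 3 m ×
    (n ≤ c * m) × (m ≤ C * n))
    × (Σ ℕ λ c → Σ ℕ λ C → Σ ℕ λ N → (n : ℕ) → n ≥ N → Σ ℕ λ m → IsM3 n 4 m ×
    (n ^ 2 ≤ c * m) × (m ≤ C * n ^ 2))
-- The lower constructions use `p = (n - 1) / 2`, where `n ≤ 4 * p` from `n = 3` on, and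
-- `p = n / 4`, where `n ≤ 7 * p` from `n = 4` on, so that `49` is the square of `7`.
theorem1p6 = pairs , (4 , 8 , 3 , triples) , (49 , 8 , 4 , quadruples)
  where
  pairs : (n : ℕ) → n ≥ 8 →
    IsM3 n 2 (n / 2)
    × (IsGraph (comatching n) × TriangleFree (comatching n) × numMIS (comatching n) 2 ≡ n / 2)
    × ((A : Adj n) → IsGraph A → TriangleFree A → numMIS A 2 ≡ n / 2 → Isomorphic A (comatching n))
  pairs n n≥8 = (upper , comatching n , attained) , attained , λ A g t size →
      Extremal.extremal⇒comatching A g t n≥8 (trans (sym (numMIS≡length A 2)) size)
    where
    open LabelledGraph (comatching-labelled n)
    upper : ∀ A → IsGraph A → TriangleFree A → numMIS A 2 ≤ n / 2
    upper A g t = subst (_≤ n / 2) (sym (numMIS≡length A 2)) (Pairs.length≤n/2 A g t n≥8)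
    attained : IsGraph (comatching n) × TriangleFree (comatching n) × numMIS (comatching n) 2 ≡ n / 2
    attained = labelled-graph , labelled-triangleFree ,
      ℕ.≤-antisym (upper (comatching n) labelled-graph labelled-triangleFree) (comatching-numMIS n)

  triples : (n : ℕ) → n ≥ 3 → Σ ℕ λ m → IsM3 n 3 m × (n ≤ 4 * m) × (m ≤ 8 * n)
  triples n@(suc n′) (s≤s n′≥2) with m , upper , A , g , t , attained ← IsM3-exists n 3 =
    m , (upper , A , g , t , attained) , lower ,
    subst₂ _≤_ attained (ℕ.*-comm n 8) (numMIS-3-bound A g t)
    where
    p = n′ / 2
    open LabelledGraph (twoBlocks-labelled {n} 1 p)
    p*2≡p+p : p * 2 ≡ p + p
    p*2≡p+p = trans (ℕ.*-comm p 2) (cong (p +_) (ℕ.+-identityʳ p))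
    p≤m : p ≤ m
    p≤m = ℕ.≤-trans (isolated+comatching-numMIS p (s≤s (subst (_≤ n′) p*2≡p+p (DivMod.m/n*n≤m n′ 2))))
                    (upper (twoBlocks 1 p) labelled-graph labelled-triangleFree)
    lower : n ≤ 4 * m
    lower = begin
      suc n′                     ≡⟨ cong suc (DivMod.m≡m%n+[m/n]*n n′ 2) ⟩
      suc (n′ % 2) + p * 2       ≤⟨ ℕ.+-monoˡ-≤ (p * 2) (DivMod.m%n<n n′ 2) ⟩
      -- The leading `1` is `2 / 2`, so `n′ ≥ 2` gives `1 ≤ p`, which absorbs the remainder and the
      -- isolated vertex.
      1 * 2 + p * 2              ≤⟨ ℕ.+-monoˡ-≤ (p * 2) (ℕ.*-monoˡ-≤ 2 (DivMod./-monoˡ-≤ 2 n′≥2)) ⟩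
      p * 2 + p * 2              ≡⟨ ℕ.*-distribˡ-+ p 2 2 ⟨
      p * 4                      ≡⟨ ℕ.*-comm p 4 ⟩
      4 * p                      ≤⟨ ℕ.*-monoʳ-≤ 4 p≤m ⟩
      4 * m                      ∎
      where open ℕ.≤-Reasoning

  quadruples : (n : ℕ) → n ≥ 4 → Σ ℕ λ m → IsM3 n 4 m × (n ^ 2 ≤ 49 * m) × (m ≤ 8 * n ^ 2)
  quadruples n n≥4 with m , upper , A , g , t , attained ← IsM3-exists n 4 =
    m , (upper , A , g , t , attained) , lower ,
    subst₂ _≤_ attained
      (solve 1 (λ n → n :* (n :* con 8) := con 8 :* (n :* (n :* con 1))) refl n) (numMIS-4-bound A g t)
    where
    open +-*-Solver
    p = n / 4
    open LabelledGraph (twoBlocks-labelled {n} (p + p) p)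
    fits : (p + p) + (p + p) ≤ n
    fits = subst (_≤ n) (solve 1 (λ p → p :* con 4 := (p :+ p) :+ (p :+ p)) refl p) (DivMod.m/n*n≤m n 4)
    p²≤m : p * p ≤ m
    p²≤m = ℕ.≤-trans (two-comatchings-numMIS p fits)
                     (upper (twoBlocks (p + p) p) labelled-graph labelled-triangleFree)
    n≤p*7 : n ≤ p * 7
    n≤p*7 = begin
      n                  ≡⟨ DivMod.m≡m%n+[m/n]*n n 4 ⟩
      n % 4 + p * 4      ≤⟨ ℕ.+-monoˡ-≤ (p * 4) (ℕ.≤-pred (DivMod.m%n<n n 4)) ⟩
      1 * 3 + p * 4      ≤⟨ ℕ.+-monoˡ-≤ (p * 4) (ℕ.*-monoˡ-≤ 3 (DivMod./-monoˡ-≤ 4 n≥4)) ⟩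
      p * 3 + p * 4      ≡⟨ ℕ.*-distribˡ-+ p 3 4 ⟨
      p * 7              ∎
      where open ℕ.≤-Reasoning
    lower : n ^ 2 ≤ 49 * m
    lower = begin
      n ^ 2              ≤⟨ ℕ.^-monoˡ-≤ 2 n≤p*7 ⟩
      (p * 7) ^ 2        ≡⟨ solve 1 (λ p → (p :* con 7) :* ((p :* con 7) :* con 1) := con 49 :* (p :* p)) refl p ⟩
      49 * (p * p)       ≤⟨ ℕ.*-monoʳ-≤ 49 p²≤m ⟩
      49 * m             ∎
      where open ℕ.≤-Reasoning
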